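{- Let $n\ge 2$ and $g\ge 3$, and let $\mathcal M^{\mathrm o}_g(n)$ be the number of MAB pairs $(u,v)$ of binary words with $|u|=|v|=n$ and $\mathrm{lsb}(u,v)+\mathrm{lsb}(v,u)-n=g$. Then $$\mathcal M^{\mathrm o}_g(n)=2\sum_{i=g+1}^{n-1}\ \sum_{l_2=0}^{n-i-2}\ \sum_{l_1=l_2+2}^{n-i}\ \sum_{k=l_1}^{g+l_2}\ \sum_{m=k'}^{n-j+k}\frac{l_1-l_2}{n-i}\binom{n-i}{l_1}\binom{n-i}{l_2}\cdot{}_{A_{l_2}}N_{A_{l_1}}^{A_k}\cdot\frac{l_1-l_2}{n-j}\binom{n-j}{m-k}\binom{n-j}{m-k'},$$ where in each term $j=n+g-i$, $k'=k+l_1-l_2$, $A_{l_1}=(l_1,n-i-l_1)$, $A_{l_2}=(l_2,n-i-l_2)$ and $A_k=(k,j-k)$ (empty sums are $0$).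
   Context: Let $\Sigma=\{a,b\}$. For a word $w$ and a letter $c$, $|w|_c$ denotes the number of occurrences of $c$ in $w$. Two words $x,y$ are abelian equivalent, written $x\sim_{\mathrm{abl}}y$, if $|x|_c=|y|_c$ for all $c\in\Sigma$. For words $u,v$: a pair $(x,y)$ is an internal abelian-border of $(u,v)$ if $x$ is a nonempty proper suffix of $u$, $y$ is a proper prefix of $v$, and $x\sim_{\mathrm{abl}}y$; it is an external abelian-border of $(u,v)$ if $x$ is a nonempty proper prefix of $u$, $y$ is a proper suffix of $v$, and $x\sim_{\mathrm{abl}}y$. The pair $(u,v)$ is mutually abelian-bordered (MAB) if it has both an internal and an external abelian-border, and mutually abelian-unbordered (MAU) if it has neither. If $(u,v)$ has an internal abelian-border, $\mathrm{sb}(u,v)$ denotes its internal abelian-border $(x,y)$ of minimal length and $\mathrm{lsb}(u,v)=|x|$ is that minimal length. A lattice path is a finite sequence of points of $\mathbb Z^2$ in which each consecutive difference is $(1,0)$ (an east step) or $(0,1)$ (a north step). The word $w(p)\in\Sigma^*$ of a lattice path $p$ records its steps in order, writing $a$ for an east step and $b$ for a north step; conversely, for a point $A\in\mathbb Z^2$ and a word $w$, $p_A(w)$ is the lattice path starting at $A$ whose word is $w$. For lattice paths $p,q$, $p\cap q$ denotes the set of lattice points lying on both. For distinct lattice points $A,B,C$, ${}_{A}\mathcal N_{B}^{C}$ is the set of triples $(p,q,p')$ where $p$ is a lattice path from $A$ to $C$, $q$ is a lattice path from $B$ to $C$, $p'=p_B(w(p))$, $p\cap q=\{C\}$ and $q\cap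 p'=\{B\}$; and ${}_{A}N_{B}^{C}=|{}_{A}\mathcal N_{B}^{C}|$. Binomial coefficients $\binom{N}{r}$ are $0$ when $r<0$ or $r>N$. -}

module Defs where

open import Data.Integer as ℤ using (ℤ; +_; -[1+_]; +[1+_]; +0)
import Data.Integer.Properties as ℤₚ
open import Data.List using (List; []; _∷_; [_]; _++_; length; map; filter; foldr; applyUpTo; head; last; tails; inits; cartesianProduct)
open import Data.List.Membership.Propositional using (_∈_; lose)
open import Data.List.Membership.Propositional.Properties using (∈-map⁺; ∈-map⁻; ∈-++⁺ˡ; ∈-++⁺ʳ; ∈-filter⁺; ∈-filter⁻; ∈-cartesianProduct⁺)
open import Data.List.Membership.Propositional.Properties.WithK using (unique∧set⇒bag)
open import Data.List.Properties using (∷-injectiveˡ; ∷-injectiveʳ)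
import Data.List.Properties as Listₚ
open import Data.List.Relation.Binary.BagAndSetEquality using (∼bag⇒↭)
open import Data.List.Relation.Binary.Permutation.Propositional.Properties using (↭-length)
open import Data.List.Relation.Binary.Pointwise using (Pointwise-≡⇒≡)
open import Data.List.Relation.Binary.Prefix.Heterogeneous using (Prefix; []; _∷_)
open import Data.List.Relation.Binary.Prefix.Heterogeneous.Properties using (prefix?)
open import Data.List.Relation.Binary.Suffix.Heterogeneous using (Suffix; here; there)
open import Data.List.Relation.Binary.Suffix.Heterogeneous.Properties using (suffix?)
open import Data.List.Relation.Unary.All as All using (All)
open import Data.List.Relation.Unary.AllPairs using ([]; _∷_)
open import Data.List.Relation.Unary.Any as Any using (Any; here; there)
open import Data.List.Relation.Unary.Linked using (Linked; []; [-]; _∷_)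
open import Data.List.Relation.Unary.Unique.Propositional using (Unique)
open import Data.List.Relation.Unary.Unique.Propositional.Properties using (map⁺; ++⁺; filter⁺; cartesianProduct⁺)
open import Data.Maybe using (just)
import Data.Maybe.Properties as Maybeₚ
open import Data.Nat as ℕ using (ℕ; zero; suc)
import Data.Nat.Combinatorics as Comb
import Data.Nat.Properties as ℕₚ
open import Data.Product using (_×_; _,_; proj₁; proj₂; ∃; ∃₂; Σ-syntax)
import Data.Product.Properties as Productₚ
open import Data.Rational as ℚ using (ℚ; 0ℚ)
open import Function.Bundles using (mk⇔)
open import Relation.Binary.Definitions using (DecidableEquality)
open import Relation.Binary.PropositionalEquality using (_≡_; _≢_; refl; sym; trans; cong; cong₂; subst)
open import Relation.Nullary using (Dec; yes; no; ¬_; ¬?; contradiction)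
open import Relation.Nullary.Decidable using (map′; _×-dec_; _→-dec_)
open import Relation.Unary using (_∩_; _≐_; ｛_｝)

------------------------------------------------------------------------
-- Cardinalities of finite sets, presented as predicates

record Enumeration {X : Set} (P : X → Set) : Set where
  field
    elements : List X
    unique   : Unique elements
    sound    : ∀ {x} → x ∈ elements → P x
    complete : ∀ {x} → P x → x ∈ elements

  size : ℕ
  size = length elements

open Enumeration public using (size)

size-unique : ∀ {X : Set} {P : X → Set} (E F : Enumeration P) → size E ≡ size F
size-unique E F = ↭-length (∼bag⇒↭ (unique∧set⇒bag E.unique F.unique
  (mk⇔ (λ x∈ → F.complete (E.sound x∈)) (λ x∈ → E.complete (F.sound x∈)))))
  where
  module E = Enumeration E
  module F = Enumeration F

------------------------------------------------------------------------
-- Words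

data Letter : Set where
  a b : Letter

Word : Set
Word = List Letter

_≟ˡ_ : DecidableEquality Letter
a ≟ˡ a = yes refl
a ≟ˡ b = no λ ()
b ≟ˡ a = no λ ()
b ≟ˡ b = yes refl

_≟ʷ_ : DecidableEquality Word
_≟ʷ_ = Listₚ.≡-dec _≟ˡ_

∣_∣[_] : Word → Letter → ℕ
∣ w ∣[ c ] = length (filter (c ≟ˡ_) w)

infix 4 _∼_

_∼_ : Word → Word → Set
x ∼ y = ∀ c → ∣ x ∣[ c ] ≡ ∣ y ∣[ c ]

_∼?_ : ∀ x y → Dec (x ∼ y)
x ∼? y = map′ (λ { (p , q) a → p ; (p , q) b → q }) (λ e → e a , e b)
  ((∣ x ∣[ a ] ℕ.≟ ∣ y ∣[ a ]) ×-dec (∣ x ∣[ b ] ℕ.≟ ∣ y ∣[ b ]))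

------------------------------------------------------------------------
-- Abelian borders

ProperPrefix ProperSuffix : Word → Word → Set
ProperPrefix x w = Prefix _≡_ x w × x ≢ w
ProperSuffix x w = Suffix _≡_ x w × x ≢ w

InternalBorder ExternalBorder : Word → Word → Word × Word → Set
InternalBorder u v (x , y) = x ≢ [] × ProperSuffix x u × ProperPrefix y v × x ∼ y
ExternalBorder u v (x , y) = x ≢ [] × ProperPrefix x u × ProperSuffix y v × x ∼ y

MAB : Word → Word → Set
MAB u v = ∃ (InternalBorder u v) × ∃ (ExternalBorder u v)

ShortestInternalBorder : Word → Word → Word × Word → Set
ShortestInternalBorder u v xy = InternalBorder u v xy ×
  (∀ xy′ → InternalBorder u v xy′ → length (proj₁ xy) ℕ.≤ length (proj₁ xy′))

-- lsb is partial, so it is given by its graph: Lsb u v l means that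
-- (u , v) has an internal abelian-border and lsb(u,v) = l.
Lsb : Word → Word → ℕ → Set
Lsb u v l = Σ[ xy ∈ Word × Word ] ShortestInternalBorder u v xy × length (proj₁ xy) ≡ l

Lsb-functional : ∀ {u v l l′} → Lsb u v l → Lsb u v l′ → l ≡ l′
Lsb-functional (xy , (B , min) , refl) (xy′ , (B′ , min′) , refl) =
  ℕₚ.≤-antisym (min xy′ B′) (min′ xy B)

MABWithExcess : ℕ → ℕ → Word × Word → Set
MABWithExcess n g (u , v) =
  length u ≡ n × length v ≡ n × MAB u v ×
  Σ[ (i , j) ∈ ℕ × ℕ ] Lsb u v i × Lsb v u j × + i ℤ.+ + j ℤ.- + n ≡ + g

prefix∈inits : ∀ {x w : Word} → Prefix _≡_ x w → x ∈ inits w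
prefix∈inits [] = here refl
prefix∈inits (refl ∷ p) with prefix∈inits p
... | here refl = there (here refl)
... | there q   = there (there (∈-map⁺ _ q))

suffix∈tails : ∀ {x w : Word} → Suffix _≡_ x w → x ∈ tails w
suffix∈tails (here p) = here (Pointwise-≡⇒≡ p)
suffix∈tails {w = _ ∷ _} (there s) = there (suffix∈tails s)

properPrefix? : ∀ x w → Dec (ProperPrefix x w)
properPrefix? x w = prefix? _≟ˡ_ x w ×-dec ¬? (x ≟ʷ w)

properSuffix? : ∀ x w → Dec (ProperSuffix x w)
properSuffix? x w = suffix? _≟ˡ_ x w ×-dec ¬? (x ≟ʷ w)

internalBorder? : ∀ u v xy → Dec (InternalBorder u v xy)
internalBorder? u v (x , y) =
  ¬? (x ≟ʷ []) ×-dec properSuffix? x u ×-dec properPrefix? y v ×-dec (x ∼? y)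

externalBorder? : ∀ u v xy → Dec (ExternalBorder u v xy)
externalBorder? u v (x , y) =
  ¬? (x ≟ʷ []) ×-dec properPrefix? x u ×-dec properSuffix? y v ×-dec (x ∼? y)

internalCandidates externalCandidates : Word → Word → List (Word × Word)
internalCandidates u v = cartesianProduct (tails u) (inits v)
externalCandidates u v = cartesianProduct (inits u) (tails v)

internal∈candidates : ∀ {u v xy} → InternalBorder u v xy → xy ∈ internalCandidates u v
internal∈candidates (_ , (s , _) , (p , _) , _) =
  ∈-cartesianProduct⁺ (suffix∈tails s) (prefix∈inits p)

external∈candidates : ∀ {u v xy} → ExternalBorder u v xy → xy ∈ externalCandidates u v
external∈candidates (_ , (p , _) , (s , _) , _) =
  ∈-cartesianProduct⁺ (prefix∈inits p) (suffix∈tails s)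

∃-within? : ∀ {X : Set} {P : X → Set} (xs : List X) →
            (∀ x → Dec (P x)) → (∀ {x} → P x → x ∈ xs) → Dec (∃ P)
∃-within? xs P? within =
  map′ Any.satisfied (λ (_ , px) → lose (within px) px) (Any.any? P? xs)

∀-within? : ∀ {X : Set} {P Q : X → Set} (xs : List X) →
            (∀ x → Dec (P x)) → (∀ x → Dec (Q x)) →
            (∀ {x} → P x → x ∈ xs) → Dec (∀ x → P x → Q x)
∀-within? xs P? Q? within =
  map′ (λ all x px → All.lookup all (within px) px) (λ f → All.tabulate (λ {x} _ → f x))
       (All.all? (λ x → P? x →-dec Q? x) xs)

mab? : ∀ u v → Dec (MAB u v)
mab? u v =
  ∃-within? (internalCandidates u v) (internalBorder? u v) internal∈candidates ×-dec
  ∃-within? (externalCandidates u v) (externalBorder? u v) external∈candidates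

shortestInternalBorder? : ∀ u v xy → Dec (ShortestInternalBorder u v xy)
shortestInternalBorder? u v xy = internalBorder? u v xy ×-dec
  ∀-within? (internalCandidates u v) (internalBorder? u v)
    (λ xy′ → length (proj₁ xy) ℕ.≤? length (proj₁ xy′)) internal∈candidates

∃Lsb? : ∀ u v → Dec (∃ (Lsb u v))
∃Lsb? u v = map′ (λ (xy , B) → length (proj₁ xy) , xy , B , refl) (λ (_ , xy , B , _) → xy , B)
  (∃-within? (internalCandidates u v) (shortestInternalBorder? u v)
             (λ (B , _) → internal∈candidates B))

excess? : ∀ n g u v →
  Dec (Σ[ (i , j) ∈ ℕ × ℕ ] Lsb u v i × Lsb v u j × + i ℤ.+ + j ℤ.- + n ≡ + g)
excess? n g u v with ∃Lsb? u v | ∃Lsb? v u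
... | no ¬I | _ = no λ ((i , _) , I , _) → ¬I (i , I)
... | _ | no ¬J = no λ ((_ , j) , _ , J , _) → ¬J (j , J)
... | yes (i , I) | yes (j , J) =
  map′ (λ e → (i , j) , I , J , e)
       (λ { (_ , I′ , J′ , e) → subst (λ (s , t) → + s ℤ.+ + t ℤ.- + n ≡ + g)
              (cong₂ _,_ (Lsb-functional I′ I) (Lsb-functional J′ J)) e })
       (+ i ℤ.+ + j ℤ.- + n ℤ.≟ + g)

mabWithExcess? : ∀ n g uv → Dec (MABWithExcess n g uv)
mabWithExcess? n g (u , v) =
  (length u ℕ.≟ n) ×-dec (length v ℕ.≟ n) ×-dec mab? u v ×-dec excess? n g u v

words : ℕ → List Word
words zero    = [ [] ]
words (suc n) = map (a ∷_) (words n) ++ map (b ∷_) (words n)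

words-unique : ∀ n → Unique (words n)
words-unique zero    = All.[] ∷ []
words-unique (suc n) = ++⁺ (map⁺ ∷-injectiveʳ (words-unique n)) (map⁺ ∷-injectiveʳ (words-unique n))
  λ (p , q) → a≢b (∈-map⁻ (a ∷_) p) (∈-map⁻ (b ∷_) q)
  where
  a≢b : ∀ {w : Word} → (∃ λ x → x ∈ words n × w ≡ a ∷ x) → ¬ (∃ λ x → x ∈ words n × w ≡ b ∷ x)
  a≢b (_ , _ , refl) (_ , _ , ())

∈-words : ∀ (w : Word) → w ∈ words (length w)
∈-words []      = here refl
∈-words (a ∷ w) = ∈-++⁺ˡ (∈-map⁺ (a ∷_) (∈-words w))
∈-words (b ∷ w) = ∈-++⁺ʳ (map (a ∷_) (words (length w))) (∈-map⁺ (b ∷_) (∈-words w))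

mabWithExcess-enumeration : ∀ n g → Enumeration (MABWithExcess n g)
mabWithExcess-enumeration n g = record
  { elements = filter (mabWithExcess? n g) pairs
  ; unique   = filter⁺ (mabWithExcess? n g) (cartesianProduct⁺ (words-unique n) (words-unique n))
  ; sound    = λ uv∈ → proj₂ (∈-filter⁻ (mabWithExcess? n g) {xs = pairs} uv∈)
  ; complete = complete
  }
  where
  pairs : List (Word × Word)
  pairs = cartesianProduct (words n) (words n)

  complete : ∀ {uv} → MABWithExcess n g uv → uv ∈ filter (mabWithExcess? n g) pairs
  complete {u , v} m@(refl , e , _) = ∈-filter⁺ (mabWithExcess? n g)
    (∈-cartesianProduct⁺ (∈-words u) (subst (λ k → v ∈ words k) e (∈-words v))) m

𝓜ᵒ : ℕ → ℕ → ℕ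
𝓜ᵒ g n = size (mabWithExcess-enumeration n g)

------------------------------------------------------------------------
-- Lattice paths

Point : Set
Point = ℤ × ℤ

_≟ᵖ_ : DecidableEquality Point
_≟ᵖ_ = Productₚ.≡-dec ℤ._≟_ ℤ._≟_

_-ᵖ_ : Point → Point → Point
(x , y) -ᵖ (x′ , y′) = x ℤ.- x′ , y ℤ.- y′

data Step (P Q : Point) : Set where
  east  : Q -ᵖ P ≡ (+ 1 , + 0) → Step P Q
  north : Q -ᵖ P ≡ (+ 0 , + 1) → Step P Q

letter : ∀ {P Q} → Step P Q → Letter
letter (east _)  = a
letter (north _) = b

word : ∀ {ps} → Linked Step ps → Word
word []       = []
word [-]      = []
word (s ∷ ss) = letter s ∷ word ss

record LatticePath (A C : Point) (ps : List Point) : Set where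
  field
    steps  : Linked Step ps
    starts : head ps ≡ just A
    ends   : last ps ≡ just C

open LatticePath public

move : Letter → Point → Point
move a (x , y) = x ℤ.+ + 1 , y
move b (x , y) = x , y ℤ.+ + 1

pathFrom : Point → Word → List Point
pathFrom A []      = [ A ]
pathFrom A (c ∷ w) = A ∷ pathFrom (move c A) w

𝒩 : (A B C : Point) → List Point × List Point × List Point → Set
𝒩 A B C (p , q , p′) = Σ[ π ∈ LatticePath A C p ] LatticePath B C q ×
  p′ ≡ pathFrom B (word (steps π)) ×
  (_∈ p) ∩ (_∈ q) ≐ ｛ C ｝ × (_∈ q) ∩ (_∈ p′) ≐ ｛ B ｝

+-minus : ∀ x y → (x ℤ.+ y) ℤ.- x ≡ y
+-minus x y = trans (cong (ℤ._- x) (ℤₚ.+-comm x y))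
  (trans (ℤₚ.+-assoc y x (ℤ.- x)) (trans (cong (λ z → y ℤ.+ z) (ℤₚ.+-inverseʳ x)) (ℤₚ.+-identityʳ y)))

minus-+ : ∀ {x y z} → y ℤ.- x ≡ z → y ≡ x ℤ.+ z
minus-+ {x} {y} refl = sym (trans (ℤₚ.+-comm x (y ℤ.- x)) (trans (ℤₚ.+-assoc y (ℤ.- x) x)
  (trans (cong (λ z → y ℤ.+ z) (ℤₚ.+-inverseˡ x)) (ℤₚ.+-identityʳ y))))

move-step : ∀ c P → Σ[ s ∈ Step P (move c P) ] letter s ≡ c
move-step a (x , y) = east (cong₂ _,_ (+-minus x (+ 1)) (ℤₚ.+-inverseʳ y)) , refl
move-step b (x , y) = north (cong₂ _,_ (ℤₚ.+-inverseʳ x) (+-minus y (+ 1))) , refl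

step-move : ∀ {P Q} (s : Step P Q) → Q ≡ move (letter s) P
step-move {P} (east e) = cong₂ _,_ (minus-+ (cong proj₁ e))
  (trans (minus-+ (cong proj₂ e)) (ℤₚ.+-identityʳ (proj₂ P)))
step-move {P} (north e) = cong₂ _,_
  (trans (minus-+ (cong proj₁ e)) (ℤₚ.+-identityʳ (proj₁ P))) (minus-+ (cong proj₂ e))

pathFrom-linked : ∀ A w → Σ[ l ∈ Linked Step (pathFrom A w) ] word l ≡ w
pathFrom-linked A []           = [-] , refl
pathFrom-linked A (c ∷ [])     = let s , e = move-step c A in s ∷ [-] , cong [_] e
pathFrom-linked A (c ∷ d ∷ w) =
  let s , e = move-step c A
      l , f = pathFrom-linked (move c A) (d ∷ w)
  in s ∷ l , cong₂ _∷_ e f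

pathFrom-head : ∀ A w → head (pathFrom A w) ≡ just A
pathFrom-head A []      = refl
pathFrom-head A (_ ∷ _) = refl

linked-pathFrom : ∀ {A ps} (l : Linked Step ps) → head ps ≡ just A → ps ≡ pathFrom A (word l)
linked-pathFrom [-]      refl = refl
linked-pathFrom (s ∷ l) refl =
  cong (_ ∷_) (trans (linked-pathFrom l refl) (cong (λ P → pathFrom P (word l)) (step-move s)))

move-injective : ∀ c d P → move c P ≡ move d P → c ≡ d
move-injective a a P e = refl
move-injective b b P e = refl
move-injective a b (x , y) e with () ← trans (sym (+-minus x (+ 1)))
  (trans (cong (ℤ._- x) (cong proj₁ e)) (ℤₚ.+-inverseʳ x))
move-injective b a (x , y) e with () ← trans (sym (+-minus y (+ 1)))
  (trans (cong (ℤ._- y) (cong proj₂ e)) (ℤₚ.+-inverseʳ y))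

pathFrom-injective : ∀ A {w w′} → pathFrom A w ≡ pathFrom A w′ → w ≡ w′
pathFrom-injective A {[]}    {[]}     e = refl
pathFrom-injective A {[]}    {_ ∷ []} ()
pathFrom-injective A {[]}    {_ ∷ _ ∷ _} ()
pathFrom-injective A {_ ∷ []} {[]} ()
pathFrom-injective A {_ ∷ _ ∷ _} {[]} ()
pathFrom-injective A {c ∷ w} {d ∷ w′} e
  with refl ← move-injective c d A (Maybeₚ.just-injective (trans
    (sym (pathFrom-head (move c A) w)) (trans (cong head (∷-injectiveʳ e)) (pathFrom-head (move d A) w′))))
  = cong (c ∷_) (pathFrom-injective (move c A) (∷-injectiveʳ e))

pathFrom-last : ∀ A {C} w → last (pathFrom A w) ≡ just C →
  C ≡ (proj₁ A ℤ.+ + ∣ w ∣[ a ] , proj₂ A ℤ.+ + ∣ w ∣[ b ])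
pathFrom-last A [] refl = sym (cong₂ _,_ (ℤₚ.+-identityʳ _) (ℤₚ.+-identityʳ _))
pathFrom-last A (c ∷ w) e = trans (pathFrom-last (move c A) w (trans (sym (last-∷ w)) e)) (shift c)
  where
  last-∷ : ∀ {P Q} w → last (P ∷ pathFrom Q w) ≡ last (pathFrom Q w)
  last-∷ []      = refl
  last-∷ (_ ∷ _) = refl

  shift : ∀ c → (proj₁ (move c A) ℤ.+ + ∣ w ∣[ a ] , proj₂ (move c A) ℤ.+ + ∣ w ∣[ b ]) ≡
                (proj₁ A ℤ.+ + ∣ c ∷ w ∣[ a ] , proj₂ A ℤ.+ + ∣ c ∷ w ∣[ b ])
  shift a = cong (_, (proj₂ A ℤ.+ + ∣ w ∣[ b ])) (ℤₚ.+-assoc (proj₁ A) (+ 1) (+ ∣ w ∣[ a ]))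
  shift b = cong ((proj₁ A ℤ.+ + ∣ w ∣[ a ]) ,_) (ℤₚ.+-assoc (proj₂ A) (+ 1) (+ ∣ w ∣[ b ]))

length-letters : ∀ w → length w ≡ ∣ w ∣[ a ] ℕ.+ ∣ w ∣[ b ]
length-letters []      = refl
length-letters (a ∷ w) = cong suc (length-letters w)
length-letters (b ∷ w) = trans (cong suc (length-letters w)) (sym (ℕₚ.+-suc _ _))

distance : Point → Point → ℕ
distance (x , y) (x′ , y′) = ℤ.∣ x′ ℤ.- x ∣ ℕ.+ ℤ.∣ y′ ℤ.- y ∣

pathFrom-length : ∀ A {C} w → last (pathFrom A w) ≡ just C → length w ≡ distance A C
pathFrom-length A w e with refl ← pathFrom-last A w e = trans (length-letters w)
  (cong₂ ℕ._+_ (cong ℤ.∣_∣ (sym (+-minus (proj₁ A) _))) (cong ℤ.∣_∣ (sym (+-minus (proj₂ A) _))))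

∩≐｛｝? : ∀ (p q : List Point) C → Dec ((_∈ p) ∩ (_∈ q) ≐ ｛ C ｝)
∩≐｛｝? p q C = map′
  (λ (f , C∈p , C∈q) → (λ {X} (X∈p , X∈q) → f X X∈p X∈q) , λ { refl → C∈p , C∈q })
  (λ (f , g) → (λ X X∈p X∈q → f (X∈p , X∈q)) , g refl)
  (∀-within? p (_∈? p) (λ X → (X ∈? q) →-dec (C ≟ᵖ X)) (λ X∈p → X∈p) ×-dec (C ∈? p) ×-dec (C ∈? q))
  where
  _∈?_ : ∀ (X : Point) ps → Dec (X ∈ ps)
  X ∈? ps = Any.any? (X ≟ᵖ_) ps

𝒩-enumeration : ∀ A B C → Enumeration (𝒩 A B C)
𝒩-enumeration A B C = record
  { elements = map triple (filter good? wordPairs)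
  ; unique   = map⁺ triple-injective (filter⁺ good?
                 (cartesianProduct⁺ (words-unique (distance A C)) (words-unique (distance B C))))
  ; sound    = λ t∈ → sound (∈-map⁻ triple t∈)
  ; complete = complete
  }
  where
  triple : Word × Word → List Point × List Point × List Point
  triple (w , z) = pathFrom A w , pathFrom B z , pathFrom B w

  triple-injective : ∀ {x y} → triple x ≡ triple y → x ≡ y
  triple-injective e = cong₂ _,_ (pathFrom-injective A (cong proj₁ e))
                                 (pathFrom-injective B (cong (λ t → proj₁ (proj₂ t)) e))

  Good : Word × Word → Set
  Good (w , z) = last (pathFrom A w) ≡ just C × last (pathFrom B z) ≡ just C ×
    (_∈ pathFrom A w) ∩ (_∈ pathFrom B z) ≐ ｛ C ｝ × (_∈ pathFrom B z) ∩ (_∈ pathFrom B w) ≐ ｛ B ｝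

  good? : ∀ wz → Dec (Good wz)
  good? (w , z) =
    Maybeₚ.≡-dec _≟ᵖ_ (last (pathFrom A w)) (just C) ×-dec
    Maybeₚ.≡-dec _≟ᵖ_ (last (pathFrom B z)) (just C) ×-dec
    ∩≐｛｝? (pathFrom A w) (pathFrom B z) C ×-dec ∩≐｛｝? (pathFrom B z) (pathFrom B w) B

  wordPairs : List (Word × Word)
  wordPairs = cartesianProduct (words (distance A C)) (words (distance B C))

  path : ∀ D w → last (pathFrom D w) ≡ just C → LatticePath D C (pathFrom D w)
  path D w e = record { steps = proj₁ (pathFrom-linked D w) ; starts = pathFrom-head D w ; ends = e }

  sound : ∀ {t} → (∃ λ wz → wz ∈ filter good? wordPairs × t ≡ triple wz) → 𝒩 A B C t
  sound ((w , z) , wz∈ , refl) with proj₂ (∈-filter⁻ good? {xs = wordPairs} wz∈)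
  ... | e , f , r , s = path A w e , path B z f ,
    cong (pathFrom B) (sym (proj₂ (pathFrom-linked A w))) , r , s

  ∈-wordsTo : ∀ D w → last (pathFrom D w) ≡ just C → w ∈ words (distance D C)
  ∈-wordsTo D w e = subst (λ k → w ∈ words k) (pathFrom-length D w e) (∈-words w)

  assemble : ∀ {p q} w z → p ≡ pathFrom A w → q ≡ pathFrom B z →
    last p ≡ just C → last q ≡ just C →
    (_∈ p) ∩ (_∈ q) ≐ ｛ C ｝ → (_∈ q) ∩ (_∈ pathFrom B w) ≐ ｛ B ｝ →
    (p , q , pathFrom B w) ∈ map triple (filter good? wordPairs)
  assemble w z refl refl e f r s = ∈-map⁺ triple (∈-filter⁺ good?
    (∈-cartesianProduct⁺ (∈-wordsTo A w e) (∈-wordsTo B z f)) (e , f , r , s))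

  complete : ∀ {t} → 𝒩 A B C t → t ∈ map triple (filter good? wordPairs)
  complete (π , ρ , refl , r , s) = assemble (word (steps π)) (word (steps ρ))
    (linked-pathFrom (steps π) (starts π)) (linked-pathFrom (steps ρ) (starts ρ))
    (ends π) (ends ρ) r s

∣𝒩∣ : (A B C : Point) → ℕ
∣𝒩∣ A B C = size (𝒩-enumeration A B C)

------------------------------------------------------------------------
-- Arithmetic

binom : ℤ → ℤ → ℕ
binom (+ N) (+ r) = N Comb.C r
binom _     _     = 0

fromℕ : ℕ → ℚ
fromℕ m = + m ℚ./ 1

infixl 7 _//_

-- The quotient of two integers, with the junk value 0 for denominator 0.
_//_ : ℤ → ℤ → ℚ
p // +0       = 0ℚ
p // +[1+ d ] = p ℚ./ suc d
p // -[1+ d ] = ℤ.- p ℚ./ suc d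

-- ⟦ lo ⋯ hi ⟧ has hi - lo + 1 entries, or none if hi < lo.
⟦_⋯_⟧ : ℤ → ℤ → List ℤ
⟦ lo ⋯ hi ⟧ = applyUpTo (λ t → lo ℤ.+ + t) ℤ.∣ + 0 ℤ.⊔ (hi ℤ.- lo ℤ.+ + 1) ∣

∑ : ℤ → ℤ → (ℤ → ℚ) → ℚ
∑ lo hi f = foldr ℚ._+_ 0ℚ (map f ⟦ lo ⋯ hi ⟧)

infix 6 ∑

syntax ∑ lo hi (λ i → e) = ∑[ i from lo to hi ] e

{-# OPTIONS --safe #-}

-- Read u in parallel with the reversal of v, as one walk of letter pairs. Two words of equal length
-- are abelian equivalent iff they contain the same number of a's, so an external (internal)
-- abelian-border of (u , v) is a proper balanced prefix (suffix) of the walk. An excess g > 0 says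
-- that the shortest balanced prefix and suffix overlap in g steps, so the walk is uniquely x₁ x₂ x₃
-- with x₁ x₂ the shortest balanced prefix and x₂ x₃ the shortest balanced suffix. Exchanging the two
-- words gives the factor 2 and lets us assume that x₁ has more a's in its first word. Given the
-- numbers of a's in the parts, the conditions on x₁, x₂, x₃ become independent: x₁ and the reversal
-- of x₃ are pairs of paths that separate at once and never meet again, counted by a 2 × 2 determinant
-- of binomials, and x₂ is an element of 𝒩. Since x₂ has at least two steps, the difference
-- l₁ - l₂ cannot be 1.
module Submission where

open import Defs
open import Data.Bool using (Bool; true; false)
open import Data.Integer as ℤ using (ℤ; +_; -[1+_]; +[1+_]; +0; _+_; _-_)
import Data.Integer.Properties as ℤₚ
open import Data.Integer.Tactic.RingSolver using (solve-∀)
open import Data.List using (List; []; _∷_; [_]; _++_; length; map; filter; foldr; reverse; drop; last;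
  cartesianProduct)
open import Data.List.Membership.Propositional using (_∈_)
open import Data.List.Membership.Propositional.Properties
  using (∈-++⁺ˡ; ∈-++⁺ʳ; ∈-++⁻; ∈-map⁻; ∈-cartesianProduct⁺; ∈-cartesianProduct⁻;
    ∈-applyUpTo⁺; ∈-applyUpTo⁻)
import Data.List.Properties as Listₚ
open import Data.List.Relation.Binary.Pointwise using (Pointwise-≡⇒≡; ≡⇒Pointwise-≡)
open import Data.List.Relation.Binary.Prefix.Heterogeneous using (Prefix; []; _∷_)
open import Data.List.Relation.Binary.Suffix.Heterogeneous using (Suffix; here; there)
open import Data.List.Relation.Unary.All as All using (All; []; _∷_)
open import Data.List.Relation.Unary.AllPairs as AllPairs using ([]; _∷_)
import Data.List.Relation.Unary.AllPairs.Properties as AllPairsₚ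
open import Data.List.Relation.Unary.Any using (here; there)
open import Data.List.Relation.Unary.Unique.Propositional using (Unique)
import Data.List.Relation.Unary.Unique.Propositional.Properties as Uniqueₚ
open import Data.Maybe using (just)
open import Data.Nat as ℕ using (ℕ; zero; suc; z≤n; s≤s; _≤_)
import Data.Nat.Combinatorics as Comb
open import Data.Nat.ListAction using (sum)
import Data.Nat.Properties as ℕₚ
import Data.Nat.Tactic.RingSolver as ℕ-Solver
open import Data.Product using (_×_; _,_; proj₁; proj₂; ∃; ∃₂; swap)
open import Data.Rational as ℚ using (ℚ; 0ℚ; _*_)
import Data.Rational.Properties as ℚₚ
import Data.Rational.Unnormalised as ℚᵘ
import Data.Rational.Unnormalised.Properties as ℚᵘₚ
open import Data.Sum using (_⊎_; inj₁; inj₂)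
open import Function using (_∘_)
open import Relation.Binary.Definitions using (Tri; tri<; tri≈; tri>)
open import Relation.Binary.PropositionalEquality
  using (_≡_; _≢_; refl; sym; trans; cong; cong₂; subst; subst₂; module ≡-Reasoning)
open import Relation.Nullary using (Dec; yes; no; ¬_; does; contradiction)
open import Relation.Nullary.Decidable using (dec-true; dec-false)
open import Relation.Unary using (_∩_; _≐_; ｛_｝; _⟨×⟩_)

open Enumeration using (elements; unique; sound; complete)

-- Enumerations

-- The independence rests on complements. Since x₂ x₃ is balanced, a balanced suffix of it that
-- starts inside x₂ leaves behind a balanced prefix of x₂; so this minimality is a condition on x₂
-- alone, read with both words starting at one point. This is why the translated path p′ occurs,
-- with q ∩ p′ = {B}. A balanced prefix of x₁ x₂ that ends inside x₂ is a meeting of two paths that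
-- start at the different points left by x₁, which gives p ∩ q = {C}. Subtracting the two balance
-- equations shows that x₃ has the same surplus l₁ - l₂ as x₁, whence k′ and the common numerator.
-- The lengths are |x₁| = n - i, |x₁ x₂| = j and |x₃| = n - j. The determinant is reached without a
-- path-switching involution: it obeys the same four-term recurrence as the count and vanishes where
-- its two arguments agree. Cardinalities travel along bijections of duplicate-free lists, and the
-- five nested sums are nested disjoint unions whose indices are functions of the triple.

private variable
  X Y Z : Set
  P Q : X → Set

-- The list is kept, so the size is preserved definitionally.
respᴱ : P ≐ Q → Enumeration P → Enumeration Q
respᴱ (P⊆Q , Q⊆P) E = record
  { elements = elements E
  ; unique   = unique E
  ; sound    = P⊆Q ∘ sound E
  ; complete = complete E ∘ Q⊆P
  }

emptyᴱ : (∀ {x} → ¬ P x) → Enumeration P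
emptyᴱ ¬P = record
  { elements = [] ; unique = [] ; sound = λ () ; complete = λ px → contradiction px ¬P }

singletonᴱ : ∀ x → P x → (∀ {y} → P y → y ≡ x) → Enumeration P
singletonᴱ x px P⇒≡ = record
  { elements = x ∷ []
  ; unique   = [] ∷ []
  ; sound    = λ { (here refl) → px }
  ; complete = here ∘ P⇒≡
  }

infixr 2 _×ᴱ_

_×ᴱ_ : Enumeration P → Enumeration Q → Enumeration (P ⟨×⟩ Q)
E ×ᴱ F = record
  { elements = cartesianProduct (elements E) (elements F)
  ; unique   = Uniqueₚ.cartesianProduct⁺ (unique E) (unique F)
  ; sound    = λ xy∈ → let x∈ , y∈ = ∈-cartesianProduct⁻ (elements E) (elements F) xy∈
                       in sound E x∈ , sound F y∈
  ; complete = λ (px , qy) → ∈-cartesianProduct⁺ (complete E px) (complete F qy)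
  }

size-×ᴱ : (E : Enumeration P) (F : Enumeration Q) → size (E ×ᴱ F) ≡ size E ℕ.* size F
size-×ᴱ E F = length-cartesianProduct (elements E) (elements F)
  where
  length-cartesianProduct : (xs : List X) (ys : List Y) →
    length (cartesianProduct xs ys) ≡ length xs ℕ.* length ys
  length-cartesianProduct []       ys = refl
  length-cartesianProduct (x ∷ xs) ys = trans (Listₚ.length-++ (map (x ,_) ys))
    (cong₂ ℕ._+_ (Listₚ.length-map (x ,_) ys) (length-cartesianProduct xs ys))

-- A union over `zs` whose index is computed from the element instead of quantified existentially;
-- in nested unions every index can then be recovered by evaluation.
Fibres : (Z → X → Set) → (X → Z) → List Z → X → Set
Fibres Q key zs x = key x ∈ zs × Q (key x) x

module _ {Q : Z → X → Set} {key : X → Z} where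

  -- Concatenation creates no duplicates: an element of two members of the family would give its
  -- single key two values.
  ⋃ᴱ : (∀ {z x} → Q z x → key x ≡ z) → ∀ {zs} → Unique zs → (∀ z → Enumeration (Q z)) →
       Enumeration (Fibres Q key zs)
  ⋃ᴱ Q⇒key {[]}     []             E = emptyᴱ λ ()
  ⋃ᴱ Q⇒key {z ∷ zs} (z∉zs ∷ zs-unique) E = record
    { elements = elements (E z) ++ elements rest
    ; unique   = Uniqueₚ.++⁺ (unique (E z)) (unique rest) λ (x∈ , x∈′) →
        All.lookup z∉zs (proj₁ (sound rest x∈′)) (sym (Q⇒key (sound (E z) x∈)))
    ; sound    = λ x∈ → from (∈-++⁻ (elements (E z)) x∈)
    ; complete = λ
        { (here refl , q) → ∈-++⁺ˡ (complete (E z) q)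
        ; (there k∈ , q)  → ∈-++⁺ʳ (elements (E z)) (complete rest (k∈ , q)) }
    }
    where
    rest = ⋃ᴱ Q⇒key zs-unique E
    from : ∀ {x} → _ → Fibres Q key (z ∷ zs) x
    from (inj₁ x∈) with q ← sound (E z) x∈ with refl ← Q⇒key q = here refl , q
    from (inj₂ x∈) with k∈ , q ← sound rest x∈ = there k∈ , q

  size-⋃ᴱ : (Q⇒key : ∀ {z x} → Q z x → key x ≡ z) → ∀ {zs} (zs-unique : Unique zs)
            (E : ∀ z → Enumeration (Q z)) →
            size (⋃ᴱ Q⇒key zs-unique E) ≡ sum (map (λ z → size (E z)) zs)
  size-⋃ᴱ Q⇒key []                         E = refl
  size-⋃ᴱ Q⇒key {z ∷ zs} (_ ∷ zs-unique) E = trans (Listₚ.length-++ (elements (E z)))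
    (cong (size (E z) ℕ.+_) (size-⋃ᴱ Q⇒key zs-unique E))

-- The map is total and only its properties are relative to `P` and `Q`, so no subtypes are needed.
-- Preimages come as data, from which `pullbackᴱ` builds its list.
record Bijection (P : X → Set) (Q : Y → Set) : Set where
  field
    to         : X → Y
    injective  : ∀ {x x′} → P x → P x′ → to x ≡ to x′ → x ≡ x′
    maps       : ∀ {x} → P x → Q (to x)
    surjective : ∀ {y} → Q y → ∃ λ x → P x × to x ≡ y

module _ {P : X → Set} {Q : Y → Set} (f : Bijection P Q) where
  open Bijection f

  private
    lift : ∀ ys → (∀ {y} → y ∈ ys → Q y) → ∃ λ xs → All P xs × map to xs ≡ ys
    lift []       Qys = [] , [] , refl
    lift (y ∷ ys) Qys =
      let x , px , fx≡y = surjective (Qys (here refl))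
          xs , pxs , e  = lift ys (Qys ∘ there)
      in x ∷ xs , px ∷ pxs , cong₂ _∷_ fx≡y e

  pullbackᴱ : Enumeration Q → Enumeration P
  pullbackᴱ E with xs , pxs , e ← lift (elements E) (sound E) = record
    { elements = xs
    ; unique   = AllPairs.map (_∘ cong to)
        (AllPairsₚ.map⁻ (subst Unique (sym e) (unique E)))
    ; sound    = All.lookup pxs
    ; complete = λ px → let x′ , x′∈ , fx≡ = ∈-map⁻ to (subst (to _ ∈_) (sym e) (complete E (maps px)))
                        in subst (_∈ xs) (sym (injective px (All.lookup pxs x′∈) fx≡)) x′∈
    }

  size-pullbackᴱ : (E : Enumeration Q) → size (pullbackᴱ E) ≡ size E
  size-pullbackᴱ E with xs , _ , e ← lift (elements E) (sound E) =
    trans (sym (Listₚ.length-map to xs)) (cong length e)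

-- Integer ranges

⟦⟧-unique : ∀ lo hi → Unique ⟦ lo ⋯ hi ⟧
⟦⟧-unique lo hi = Uniqueₚ.applyUpTo⁺₁ _ _ λ i<j _ e →
  ℕₚ.<⇒≢ i<j (ℤₚ.+-injective (trans (sym (+-minus lo _)) (trans (cong (_- lo) e) (+-minus lo _))))

-- The natural numbers `r` and `s` are the slacks in the two bounds; they replace integer
-- inequalities by equations that the ring solver can treat.
∈-⟦⟧⁺ : ∀ lo hi {z} r s → z ≡ lo + + r → hi ≡ z + + s → z ∈ ⟦ lo ⋯ hi ⟧
∈-⟦⟧⁺ lo _ r s refl refl = ∈-applyUpTo⁺ _
  (subst (λ e → r ℕ.< ℤ.∣ + 0 ℤ.⊔ e ∣) (sym entries) (s≤s (ℕₚ.m≤m+n r s)))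
  where
  entries : lo + + r + + s - lo + + 1 ≡ + suc (r ℕ.+ s)
  entries = trans (rearrange lo (+ r) (+ s)) (cong +_ (ℕₚ.+-comm (r ℕ.+ s) 1))
    where
    rearrange : ∀ x y z → x + y + z - x + + 1 ≡ y + z + + 1
    rearrange = solve-∀

∈-⟦⟧⁻ : ∀ lo hi {z} → z ∈ ⟦ lo ⋯ hi ⟧ → (∃ λ r → z ≡ lo + + r) × (∃ λ s → hi ≡ z + + s)
∈-⟦⟧⁻ lo hi z∈ with ∈-applyUpTo⁻ (λ t → lo + + t) z∈
... | r , r< , refl = (r , refl) , above (hi - lo + + 1) refl r<
  where
  rearrange : ∀ x y → y ≡ x + (y - x + + 1) - + 1
  rearrange = solve-∀

  above : ∀ e → hi - lo + + 1 ≡ e → r ℕ.< ℤ.∣ + 0 ℤ.⊔ e ∣ → ∃ λ s → hi ≡ lo + + r + + s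
  -- For `e` zero or negative the truncation at 0 leaves the range empty, so no other case is
  -- inhabited.
  above (+ suc m) e (s≤s r≤m) with ℕₚ.m≤n⇒∃[o]m+o≡n r≤m
  ... | s , refl = s , trans (rearrange lo hi) (trans (cong (λ x → lo + x - + 1) e)
    (trans (cong (λ x → lo + + x - + 1) (ℕₚ.+-comm 1 (r ℕ.+ s))) (regroup lo (+ r) (+ s))))
    where
    regroup : ∀ x y z → x + (y + z + + 1) - + 1 ≡ x + y + z
    regroup = solve-∀

-- Rational sums and products of naturals

-- Since `ℚ.fromℚᵘ` unfolds to `ℚ._/_`, products of quotients can be computed on unnormalised
-- fractions, away from greatest common divisors.
fromℚᵘ-homo-* : ∀ p q → ℚ.fromℚᵘ p * ℚ.fromℚᵘ q ≡ ℚ.fromℚᵘ (p ℚᵘ.* q)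
fromℚᵘ-homo-* p q = ℚₚ.toℚᵘ-injective (ℚᵘₚ.≃-trans (ℚₚ.toℚᵘ-homo-* (ℚ.fromℚᵘ p) (ℚ.fromℚᵘ q))
  (ℚᵘₚ.≃-trans (ℚᵘₚ.*-cong (ℚₚ.toℚᵘ-fromℚᵘ p) (ℚₚ.toℚᵘ-fromℚᵘ q))
    (ℚᵘₚ.≃-sym (ℚₚ.toℚᵘ-fromℚᵘ (p ℚᵘ.* q)))))

fromℚᵘ-homo-+ : ∀ p q → ℚ.fromℚᵘ p ℚ.+ ℚ.fromℚᵘ q ≡ ℚ.fromℚᵘ (p ℚᵘ.+ q)
fromℚᵘ-homo-+ p q = ℚₚ.toℚᵘ-injective (ℚᵘₚ.≃-trans (ℚₚ.toℚᵘ-homo-+ (ℚ.fromℚᵘ p) (ℚ.fromℚᵘ q))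
  (ℚᵘₚ.≃-trans (ℚᵘₚ.+-cong (ℚₚ.toℚᵘ-fromℚᵘ p) (ℚₚ.toℚᵘ-fromℚᵘ q))
    (ℚᵘₚ.≃-sym (ℚₚ.toℚᵘ-fromℚᵘ (p ℚᵘ.+ q)))))

fromℕ-+ : ∀ m n → fromℕ (m ℕ.+ n) ≡ fromℕ m ℚ.+ fromℕ n
fromℕ-+ m n = sym (trans (fromℚᵘ-homo-+ (ℚᵘ.mkℚᵘ (+ m) 0) (ℚᵘ.mkℚᵘ (+ n) 0))
  (cong (ℚ._/ 1) (clear (+ m) (+ n))))
  where
  clear : ∀ x y → x ℤ.* + 1 + y ℤ.* + 1 ≡ x + y
  clear = solve-∀

fromℕ-* : ∀ m n → fromℕ (m ℕ.* n) ≡ fromℕ m * fromℕ n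
fromℕ-* m n = sym (trans (fromℚᵘ-homo-* (ℚᵘ.mkℚᵘ (+ m) 0) (ℚᵘ.mkℚᵘ (+ n) 0))
  (cong (ℚ._/ 1) (sym (ℤₚ.pos-* m n))))

fromℕ-sum : ∀ {Z : Set} (zs : List Z) (s : Z → ℕ) (f : Z → ℚ) →
  (∀ {z} → z ∈ zs → fromℕ (s z) ≡ f z) →
  fromℕ (sum (map s zs)) ≡ foldr ℚ._+_ 0ℚ (map f zs)
fromℕ-sum []       s f s≡f = refl
fromℕ-sum (z ∷ zs) s f s≡f = trans (fromℕ-+ (s z) _)
  (cong₂ ℚ._+_ (s≡f (here refl)) (fromℕ-sum zs s f (s≡f ∘ there)))

-- Binomial coefficients with integer lower entry

B : ℕ → ℤ → ℤ
B N l = + binom (+ N) l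

nC0≡1 : ∀ N → N Comb.C 0 ≡ 1
nC0≡1 N = trans (Comb.nCk≡nC[n∸k] {0} {N} z≤n) (Comb.nCn≡1 N)

-- The value 0 at negative lower entries removes the boundary case: at `l = 0` the second summand
-- vanishes.
pascal : ∀ N l → B (suc N) l ≡ B N l + B N (l - + 1)
pascal N -[1+ r ] = refl
pascal N +0       = cong +_ (trans (nC0≡1 (suc N)) (sym (cong (ℕ._+ 0) (nC0≡1 N))))
pascal N +[1+ r ] = cong +_ (trans (sym (Comb.nCk+nC[k+1]≡[n+1]C[k+1] N r))
  (ℕₚ.+-comm (N Comb.C r) (N Comb.C suc r)))

-- After Pascal's rule, splitting `l` as (l - 1) + 1 on the second summand gives two instances of
-- the induction hypothesis and one spare term, which raises the factor from N + 1 to N + 2.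
absorption : ∀ N l → l ℤ.* B (suc N) l ≡ + suc N ℤ.* B N (l - + 1)
absorption zero (+ 0)           = refl
absorption zero (+ 1)           = refl
absorption zero (+ suc (suc r)) = trans (cong (λ x → + suc (suc r) ℤ.* + x)
  (Comb.k>n⇒nCk≡0 {1} {suc (suc r)} (s≤s (s≤s z≤n))))
  (trans (ℤₚ.*-zeroʳ (+ suc (suc r))) (cong (λ x → + 1 ℤ.* + x)
    (sym (Comb.k>n⇒nCk≡0 {0} {suc r} (s≤s z≤n)))))
absorption zero -[1+ r ] = ℤₚ.*-zeroʳ -[1+ r ]
absorption (suc N) l = begin
  l ℤ.* B (2 ℕ.+ N) l
    ≡⟨ cong (l ℤ.*_) (pascal (suc N) l) ⟩
  l ℤ.* (B (suc N) l + B (suc N) (l - + 1))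
    ≡⟨ expand l (B (suc N) l) (B (suc N) (l - + 1)) ⟩
  l ℤ.* B (suc N) l + (l - + 1) ℤ.* B (suc N) (l - + 1) + B (suc N) (l - + 1)
    ≡⟨ cong₂ (λ x y → x + y + B (suc N) (l - + 1)) (absorption N l) (absorption N (l - + 1)) ⟩
  + suc N ℤ.* B N (l - + 1) + + suc N ℤ.* B N (l - + 1 - + 1) + B (suc N) (l - + 1)
    ≡⟨ cong (_+ B (suc N) (l - + 1)) (ℤₚ.*-distribˡ-+ (+ suc N) (B N (l - + 1)) _) ⟨
  + suc N ℤ.* (B N (l - + 1) + B N (l - + 1 - + 1)) + B (suc N) (l - + 1)
    ≡⟨ cong (λ x → + suc N ℤ.* x + B (suc N) (l - + 1)) (pascal N (l - + 1)) ⟨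
  + suc N ℤ.* B (suc N) (l - + 1) + B (suc N) (l - + 1)
    ≡⟨ collect (+ suc N) (B (suc N) (l - + 1)) ⟩
  + (2 ℕ.+ N) ℤ.* B (suc N) (l - + 1) ∎
  where
  open ≡-Reasoning
  expand : ∀ l x y → l ℤ.* (x + y) ≡ l ℤ.* x + (l - + 1) ℤ.* y + y
  expand = solve-∀
  collect : ∀ m x → m ℤ.* x + x ≡ (+ 1 + m) ℤ.* x
  collect = solve-∀

-- Pascal's rule multiplied by N + 1, minus `absorption`.
absorption′ : ∀ N l → (+ suc N - l) ℤ.* B (suc N) l ≡ + suc N ℤ.* B N l
absorption′ N l = begin
  (+ suc N - l) ℤ.* B (suc N) l
    ≡⟨ distribute (+ suc N) l (B (suc N) l) ⟩
  + suc N ℤ.* B (suc N) l - l ℤ.* B (suc N) l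
    ≡⟨ cong₂ (λ x y → + suc N ℤ.* x - y) (pascal N l) (absorption N l) ⟩
  + suc N ℤ.* (B N l + B N (l - + 1)) - + suc N ℤ.* B N (l - + 1)
    ≡⟨ cancel (+ suc N) (B N l) (B N (l - + 1)) ⟩
  + suc N ℤ.* B N l ∎
  where
  open ≡-Reasoning
  distribute : ∀ m l x → (m - l) ℤ.* x ≡ m ℤ.* x - l ℤ.* x
  distribute = solve-∀
  cancel : ∀ m x y → m ℤ.* (x + y) - m ℤ.* y ≡ m ℤ.* x
  cancel = solve-∀

-- The Lindström–Gessel–Viennot determinant for pairs of paths whose first steps differ.
G : ℕ → ℤ → ℤ → ℤ
G N l₁ l₂ = B N (l₁ - + 1) ℤ.* B N l₂ - B N l₁ ℤ.* B N (l₂ - + 1)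

G-diagonal : ∀ N l → G N l l ≡ + 0
G-diagonal N l = cancel (B N (l - + 1)) (B N l)
  where
  cancel : ∀ x y → x ℤ.* y - y ℤ.* x ≡ + 0
  cancel = solve-∀

-- Bilinearity of the determinant together with Pascal's rule. The four summands follow the order of
-- `stepPairs`, where a letter `a` lowers its count by one.
G-suc : ∀ N l₁ l₂ → G (suc N) l₁ l₂ ≡
  G N (l₁ - + 1) (l₂ - + 1) + (G N (l₁ - + 1) l₂ + (G N l₁ (l₂ - + 1) + G N l₁ l₂))
G-suc N l₁ l₂ = trans
  (cong₂ _-_ (cong₂ ℤ._*_ (pascal N (l₁ - + 1)) (pascal N l₂))
             (cong₂ ℤ._*_ (pascal N l₁) (pascal N (l₂ - + 1))))
  (expand (B N l₁) (B N (l₁ - + 1)) (B N (l₁ - + 1 - + 1)) (B N l₂) (B N (l₂ - + 1))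
    (B N (l₂ - + 1 - + 1)))
  where
  expand : ∀ x x′ x″ y y′ y″ →
    (x′ + x″) ℤ.* (y + y′) - (x + x′) ℤ.* (y′ + y″) ≡
    (x″ ℤ.* y′ - x′ ℤ.* y″) + ((x″ ℤ.* y - x′ ℤ.* y′)
      + ((x′ ℤ.* y′ - x ℤ.* y″) + (x′ ℤ.* y - x ℤ.* y′)))
  expand = solve-∀

-- A second factor M = N + 1 lets every binomial of the determinant absorb one. All become multiples
-- of `x` or `y`, and l₁ (M - l₂) - (M - l₁) l₂ = M (l₁ - l₂).
G-closed : ∀ N l₁ l₂ → + suc N ℤ.* G N l₁ l₂ ≡ (l₁ - l₂) ℤ.* B (suc N) l₁ ℤ.* B (suc N) l₂
G-closed N l₁ l₂ = ℤₚ.*-cancelˡ-≡ (+ suc N) _ _ (begin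
  M ℤ.* (M ℤ.* G N l₁ l₂)
    ≡⟨ distribute M (B N (l₁ - + 1)) (B N l₂) (B N l₁) (B N (l₂ - + 1)) ⟩
  (M ℤ.* B N (l₁ - + 1)) ℤ.* (M ℤ.* B N l₂) - (M ℤ.* B N l₁) ℤ.* (M ℤ.* B N (l₂ - + 1))
    ≡⟨ cong₂ _-_ (cong₂ ℤ._*_ (absorption N l₁) (absorption′ N l₂))
                 (cong₂ ℤ._*_ (absorption′ N l₁) (absorption N l₂)) ⟨
  (l₁ ℤ.* x) ℤ.* ((M - l₂) ℤ.* y) - ((M - l₁) ℤ.* x) ℤ.* (l₂ ℤ.* y)
    ≡⟨ collect M l₁ l₂ x y ⟩
  M ℤ.* ((l₁ - l₂) ℤ.* x ℤ.* y) ∎)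
  where
  open ≡-Reasoning
  M = + suc N
  x = B (suc N) l₁
  y = B (suc N) l₂
  distribute : ∀ m p q r s → m ℤ.* (m ℤ.* (p ℤ.* q - r ℤ.* s)) ≡ (m ℤ.* p) ℤ.*
    (m ℤ.* q) - (m ℤ.* r) ℤ.* (m ℤ.* s)
  distribute = solve-∀
  collect : ∀ m l k x y → (l ℤ.* x) ℤ.* ((m - k) ℤ.* y) - ((m - l) ℤ.* x) ℤ.* (k ℤ.* y) ≡ m ℤ.*
    ((l - k) ℤ.* x ℤ.* y)
  collect = solve-∀

quotient-formula : ∀ N (d : ℤ) x y s → + suc N ℤ.* + s ≡ d ℤ.* + x ℤ.* + y →
  fromℕ s ≡ d // + suc N * fromℕ x * fromℕ y
quotient-formula N d x y s e = sym (begin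
  d // + suc N * fromℕ x * fromℕ y
    ≡⟨ cong (_* fromℕ y) (fromℚᵘ-homo-* (ℚᵘ.mkℚᵘ d N) (ℚᵘ.mkℚᵘ (+ x) 0)) ⟩
  ℚ.fromℚᵘ (ℚᵘ.mkℚᵘ d N ℚᵘ.* ℚᵘ.mkℚᵘ (+ x) 0) * fromℕ y
    ≡⟨ fromℚᵘ-homo-* (ℚᵘ.mkℚᵘ d N ℚᵘ.* ℚᵘ.mkℚᵘ (+ x) 0) (ℚᵘ.mkℚᵘ (+ y) 0) ⟩
  ℚ.fromℚᵘ (ℚᵘ.mkℚᵘ d N ℚᵘ.* ℚᵘ.mkℚᵘ (+ x) 0 ℚᵘ.* ℚᵘ.mkℚᵘ (+ y) 0)
    ≡⟨ ℚₚ.fromℚᵘ-cong {ℚᵘ.mkℚᵘ d N ℚᵘ.* ℚᵘ.mkℚᵘ (+ x) 0 ℚᵘ.* ℚᵘ.mkℚᵘ (+ y) 0} {ℚᵘ.mkℚᵘ (+ s) 0}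
         (ℚᵘ.*≡* (trans (cong (ℤ._* + 1) (sym e))
           (trans (clear (+ suc N) (+ s)) (cong (λ k → + s ℤ.* + k)
           (sym (trans (ℕₚ.*-identityʳ _) (ℕₚ.*-identityʳ (suc N)))))))) ⟩
  fromℕ s ∎)
  where
  open ≡-Reasoning
  clear : ∀ m s → m ℤ.* s ℤ.* + 1 ≡ s ℤ.* m
  clear = solve-∀

-- Walks

∣++∣ : ∀ u v c → ∣ u ++ v ∣[ c ] ≡ ∣ u ∣[ c ] ℕ.+ ∣ v ∣[ c ]
∣++∣ u v c = trans (cong length (Listₚ.filter-++ (c ≟ˡ_) u v))
  (Listₚ.length-++ (filter (c ≟ˡ_) u))

∣reverse∣ : ∀ w c → ∣ reverse w ∣[ c ] ≡ ∣ w ∣[ c ]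
∣reverse∣ []      c = refl
∣reverse∣ (d ∷ w) c = begin
  ∣ reverse (d ∷ w) ∣[ c ]               ≡⟨ cong ∣_∣[ c ] (Listₚ.unfold-reverse d w) ⟩
  ∣ reverse w ++ [ d ] ∣[ c ]            ≡⟨ ∣++∣ (reverse w) [ d ] c ⟩
  ∣ reverse w ∣[ c ] ℕ.+ ∣ [ d ] ∣[ c ]  ≡⟨ cong (ℕ._+ ∣ [ d ] ∣[ c ]) (∣reverse∣ w c) ⟩
  ∣ w ∣[ c ] ℕ.+ ∣ [ d ] ∣[ c ]          ≡⟨ ℕₚ.+-comm ∣ w ∣[ c ] _ ⟩
  ∣ [ d ] ∣[ c ] ℕ.+ ∣ w ∣[ c ]          ≡⟨ ∣++∣ [ d ] w c ⟨
  ∣ d ∷ w ∣[ c ]                         ∎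
  where open ≡-Reasoning

Walk : Set
Walk = List (Letter × Letter)

#₁ #₂ : Walk → ℕ
#₁ x = ∣ map proj₁ x ∣[ a ]
#₂ x = ∣ map proj₂ x ∣[ a ]

#₁-++ : ∀ x y → #₁ (x ++ y) ≡ #₁ x ℕ.+ #₁ y
#₁-++ x y = trans (cong ∣_∣[ a ] (Listₚ.map-++ proj₁ x y)) (∣++∣ (map proj₁ x) _ a)

#₂-++ : ∀ x y → #₂ (x ++ y) ≡ #₂ x ℕ.+ #₂ y
#₂-++ x y = trans (cong ∣_∣[ a ] (Listₚ.map-++ proj₂ x y)) (∣++∣ (map proj₂ x) _ a)

#₁-reverse : ∀ x → #₁ (reverse x) ≡ #₁ x
#₁-reverse x = trans (cong ∣_∣[ a ] (Listₚ.reverse-map proj₁ x)) (∣reverse∣ (map proj₁ x) a)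

#₂-reverse : ∀ x → #₂ (reverse x) ≡ #₂ x
#₂-reverse x = trans (cong ∣_∣[ a ] (Listₚ.reverse-map proj₂ x)) (∣reverse∣ (map proj₂ x) a)

Balanced : Walk → Set
Balanced x = #₁ x ≡ #₂ x

NoBalancedSuffix NoBalancedPrefix : Walk → Set
NoBalancedSuffix x = ∀ p q → x ≡ p ++ q → q ≢ [] → ¬ Balanced q
NoBalancedPrefix x = ∀ p q → x ≡ p ++ q → p ≢ [] → ¬ Balanced p

noBalancedSuffix-∷⁺ : ∀ {s x} → ¬ Balanced (s ∷ x) → NoBalancedSuffix x → NoBalancedSuffix (s ∷ x)
noBalancedSuffix-∷⁺ ¬b nbs []      _ refl _  = ¬b
noBalancedSuffix-∷⁺ ¬b nbs (_ ∷ p) q refl q≢ = nbs p q refl q≢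

noBalancedSuffix-∷⁻ : ∀ {s x} → NoBalancedSuffix (s ∷ x) → ¬ Balanced (s ∷ x) × NoBalancedSuffix x
noBalancedSuffix-∷⁻ {s} nbs = nbs [] _ refl (λ ()) , λ p q e → nbs (s ∷ p) q (cong (s ∷_) e)

-- Walks that meet only at their end

-- The condition concerns suffixes, so it passes to the tail of a list and recursion on the first
-- step is possible; x₁, where prefixes matter, is therefore reversed. Integer parameters accept
-- differences such as n - i directly, negative ones giving the empty set.
Sep : ℤ → ℤ → ℤ → Walk → Set
Sep z l₁ l₂ x = + length x ≡ z × + #₁ x ≡ l₁ × + #₂ x ≡ l₂ × NoBalancedSuffix x

back : Letter → ℤ → ℤ
back a l = l - + 1
back b l = l

1+[i-1] : ∀ i → ℤ.suc (i - + 1) ≡ i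
1+[i-1] i = lemma i
  where
  lemma : ∀ x → + 1 + (x - + 1) ≡ x
  lemma = solve-∀

private
  back⁺ : ∀ c w {l} → + ∣ c ∷ w ∣[ a ] ≡ l → + ∣ w ∣[ a ] ≡ back c l
  back⁺ a w refl = sym (+-minus (+ 1) _)
  back⁺ b w refl = refl

  back⁻ : ∀ c w {l} → + ∣ w ∣[ a ] ≡ back c l → + ∣ c ∷ w ∣[ a ] ≡ l
  back⁻ a w {l} e = trans (cong ℤ.suc e) (1+[i-1] l)
  back⁻ b w e = e

-- The value at `[]` is a dummy, as every walk in a `Branch` has a first step.
firstStep : Walk → Letter × Letter
firstStep []      = a , a
firstStep (s ∷ _) = s

stepPairs : List (Letter × Letter)
stepPairs = (a , a) ∷ (a , b) ∷ (b , a) ∷ (b , b) ∷ []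

stepPairs-unique : Unique stepPairs
stepPairs-unique = ((λ ()) ∷ (λ ()) ∷ (λ ()) ∷ []) ∷ ((λ ()) ∷ (λ ()) ∷ []) ∷ ((λ ()) ∷ []) ∷ []
  ∷ []

∈-stepPairs : ∀ s → s ∈ stepPairs
∈-stepPairs (a , a) = here refl
∈-stepPairs (a , b) = there (here refl)
∈-stepPairs (b , a) = there (there (here refl))
∈-stepPairs (b , b) = there (there (there (here refl)))

Branch : ℕ → ℤ → ℤ → Letter × Letter → Walk → Set
Branch N l₁ l₂ (c , d) x = ∃ λ y → x ≡ (c , d) ∷ y × Sep (+ N) (back c l₁) (back d l₂) y

Branch⇒firstStep : ∀ {N l₁ l₂ cd x} → Branch N l₁ l₂ cd x → firstStep x ≡ cd
Branch⇒firstStep (_ , refl , _) = refl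

branch-bijection : ∀ {N l₁ l₂} c d →
  Bijection (Branch N l₁ l₂ (c , d)) (Sep (+ N) (back c l₁) (back d l₂))
branch-bijection c d = record
  { to         = drop 1
  ; injective  = λ { (_ , refl , _) (_ , refl , _) refl → refl }
  ; maps       = λ { (_ , refl , s) → s }
  ; surjective = λ {y} s → (c , d) ∷ y , (y , refl , s) , refl
  }

module _ {N} (rec : ∀ l₁ l₂ → Enumeration (Sep (+ N) l₁ l₂)) (l₁ l₂ : ℤ) where

  branchᴱ : ∀ cd → Enumeration (Branch N l₁ l₂ cd)
  branchᴱ (c , d) = pullbackᴱ (branch-bijection c d) (rec (back c l₁) (back d l₂))

  size-branchᴱ : ∀ c d → size (branchᴱ (c , d)) ≡ size (rec (back c l₁) (back d l₂))
  size-branchᴱ c d = size-pullbackᴱ (branch-bijection c d) (rec (back c l₁) (back d l₂))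

sep-zeroᴱ : ∀ {l₁ l₂} → Dec (l₁ ≡ + 0) → Dec (l₂ ≡ + 0) → Enumeration (Sep (+ 0) l₁ l₂)
sep-zeroᴱ (yes refl) (yes refl) = singletonᴱ []
  (refl , refl , refl , λ { [] _ refl []≢[] → contradiction refl []≢[] })
  λ { {[]} _ → refl }
sep-zeroᴱ (no l₁≢0) _ = emptyᴱ λ { {[]} (_ , e , _) → l₁≢0 (sym e) }
sep-zeroᴱ (yes refl) (no l₂≢0) = emptyᴱ λ { {[]} (_ , _ , e , _) → l₂≢0 (sym e) }

-- If `l₁ ≡ l₂`, the whole walk is a forbidden balanced suffix. Otherwise the whole walk is
-- harmless, only the condition on the tail remains, and the first step partitions the walks.
sep-sucᴱ : ∀ {N l₁ l₂} → (∀ l₁ l₂ → Enumeration (Sep (+ N) l₁ l₂)) → Dec (l₁ ≡ l₂) →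
           Enumeration (Sep (+ suc N) l₁ l₂)
sep-sucᴱ rec (yes refl) = emptyᴱ λ
  { {_ ∷ _} (_ , e₁ , e₂ , nbs) →
    proj₁ (noBalancedSuffix-∷⁻ nbs) (ℤₚ.+-injective (trans e₁ (sym e₂))) }
sep-sucᴱ {N} {l₁} {l₂} rec (no l₁≢l₂) = respᴱ (merge , split)
  (⋃ᴱ Branch⇒firstStep stepPairs-unique (branchᴱ rec l₁ l₂))
  where
  merge : ∀ {x} → Fibres (Branch N l₁ l₂) firstStep stepPairs x → Sep (+ suc N) l₁ l₂ x
  merge {(c , d) ∷ y} (_ , _ , refl , n≡ , e₁ , e₂ , nbs) =
    let f₁ = back⁻ c (map proj₁ y) e₁
        f₂ = back⁻ d (map proj₂ y) e₂
    in cong ℤ.suc n≡ , f₁ , f₂ ,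
       noBalancedSuffix-∷⁺ (λ e → l₁≢l₂ (trans (sym f₁) (trans (cong +_ e) f₂))) nbs

  split : ∀ {x} → Sep (+ suc N) l₁ l₂ x → Fibres (Branch N l₁ l₂) firstStep stepPairs x
  split {(c , d) ∷ y} (n≡ , f₁ , f₂ , nbs) = ∈-stepPairs (c , d) , y , refl ,
    cong +_ (ℕₚ.suc-injective (ℤₚ.+-injective n≡)) , back⁺ c (map proj₁ y) f₁ ,
      back⁺ d (map proj₂ y) f₂ ,
    proj₂ (noBalancedSuffix-∷⁻ nbs)

sepᴱ : ∀ z l₁ l₂ → Enumeration (Sep z l₁ l₂)
sepᴱ (+ zero)  l₁ l₂ = sep-zeroᴱ (l₁ ℤ.≟ + 0) (l₂ ℤ.≟ + 0)
sepᴱ (+ suc N) l₁ l₂ = sep-sucᴱ (sepᴱ (+ N)) (l₁ ℤ.≟ l₂)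
sepᴱ -[1+ _ ]  l₁ l₂ = emptyᴱ λ ()

B₀-nonzero : ∀ {l} → l ≢ + 0 → B 0 l ≡ + 0
B₀-nonzero {+0}       l≢0 = contradiction refl l≢0
B₀-nonzero {+[1+ r ]} _   = refl
B₀-nonzero { -[1+ _ ]} _   = refl

-- `B 0` is the indicator of 0.
B₀-distinct : ∀ i j → i ≢ j → B 0 i ℤ.* B 0 j ≡ + 0
B₀-distinct i j i≢j with i ℤ.≟ + 0
... | no i≢0   = trans (cong (ℤ._* B 0 j) (B₀-nonzero i≢0)) (ℤₚ.*-zeroˡ (B 0 j))
... | yes refl = trans (cong (B 0 i ℤ.*_) (B₀-nonzero (i≢j ∘ sym))) (ℤₚ.*-zeroʳ (B 0 i))

size-sep-zero : ∀ {l₁ l₂} (d₁ : Dec (l₁ ≡ + 0)) (d₂ : Dec (l₂ ≡ + 0)) →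
                + size (sep-zeroᴱ d₁ d₂) ≡ B 0 l₁ ℤ.* B 0 l₂
size-sep-zero (yes refl) (yes refl) = refl
size-sep-zero {l₂ = l₂} (no l₁≢0) _ = sym (trans (cong (ℤ._* B 0 l₂) (B₀-nonzero l₁≢0))
  (ℤₚ.*-zeroˡ (B 0 l₂)))
size-sep-zero {l₁} (yes refl) (no l₂≢0) = sym
  (trans (cong (B 0 l₁ ℤ.*_) (B₀-nonzero l₂≢0)) (ℤₚ.*-zeroʳ (B 0 l₁)))

<⇒≤-1 : ∀ {i j} → i ℤ.< j → i ℤ.≤ j - + 1
<⇒≤-1 {j = j} i<j = subst (_ ℤ.≤_) (ℤₚ.+-comm ℤ.-1ℤ j) (ℤₚ.i<j⇒i≤pred[j] i<j)

-1≤ : ∀ i → i - + 1 ℤ.≤ i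
-1≤ i = ℤₚ.i≤j⇒i-k≤j (+ 1) ℤₚ.≤-refl

-1< : ∀ i → i - + 1 ℤ.< i
-1< i = ℤₚ.i≤pred[j]⇒i<j (ℤₚ.≤-reflexive (ℤₚ.+-comm i ℤ.-1ℤ))

-- Both sides vanish on the diagonal and obey the recurrence of `G-suc` off it. The order of `l₁`
-- and `l₂` matters because `G` is antisymmetric; strictly above the diagonal, all four neighbours
-- still satisfy the weak inequality.
size-sep : ∀ N {l₁ l₂} → l₂ ℤ.≤ l₁ → + size (sepᴱ (+ suc N) l₁ l₂) ≡ G N l₁ l₂
size-sep N {l₁} {l₂} l₂≤l₁ = go N (l₁ ℤ.≟ l₂)
  where
  open ≡-Reasoning

  branches : ∀ N (l₁≢l₂ : l₁ ≢ l₂) → + size (sep-sucᴱ (sepᴱ (+ N)) (no l₁≢l₂)) ≡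
    + size (sepᴱ (+ N) (l₁ - + 1) (l₂ - + 1)) + (+ size (sepᴱ (+ N) (l₁ - + 1) l₂) +
      (+ size (sepᴱ (+ N) l₁ (l₂ - + 1)) + + size (sepᴱ (+ N) l₁ l₂)))
  branches N l₁≢l₂ = cong +_ (trans
    (size-⋃ᴱ Branch⇒firstStep stepPairs-unique (branchᴱ (sepᴱ (+ N)) l₁ l₂))
    (cong₂ ℕ._+_ (size-branchᴱ (sepᴱ (+ N)) l₁ l₂ a a)
      (cong₂ ℕ._+_ (size-branchᴱ (sepᴱ (+ N)) l₁ l₂ a b)
      (cong₂ ℕ._+_ (size-branchᴱ (sepᴱ (+ N)) l₁ l₂ b a)
        (trans (ℕₚ.+-identityʳ _) (size-branchᴱ (sepᴱ (+ N)) l₁ l₂ b b))))))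

  go : ∀ N (d : Dec (l₁ ≡ l₂)) → + size (sep-sucᴱ (sepᴱ (+ N)) d) ≡ G N l₁ l₂
  go N       (yes refl)  = sym (G-diagonal N l₁)
  -- Only the single step `(a , b)` can survive: `(a , a)` and `(b , b)` need equal counts, and
  -- `(b , a)` needs `l₁` below `l₂`.
  go zero    (no l₁≢l₂) = begin
    + size (sep-sucᴱ (sepᴱ (+ 0)) (no l₁≢l₂))
      ≡⟨ branches 0 l₁≢l₂ ⟩
    _
      ≡⟨ cong₂ _+_ (size-sep-zero (l₁ - + 1 ℤ.≟ + 0) (l₂ - + 1 ℤ.≟ + 0))
          (cong₂ _+_ (size-sep-zero (l₁ - + 1 ℤ.≟ + 0) (l₂ ℤ.≟ + 0))
          (cong₂ _+_ (size-sep-zero (l₁ ℤ.≟ + 0) (l₂ - + 1 ℤ.≟ + 0))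
                     (size-sep-zero (l₁ ℤ.≟ + 0) (l₂ ℤ.≟ + 0)))) ⟩
    B 0 (l₁ - + 1) ℤ.* B 0 (l₂ - + 1) + (B 0 (l₁ - + 1) ℤ.* B 0 l₂ +
      (B 0 l₁ ℤ.* B 0 (l₂ - + 1) + B 0 l₁ ℤ.* B 0 l₂))
      ≡⟨ cong₂ _+_ (B₀-distinct (l₁ - + 1) (l₂ - + 1)
        (λ e → l₁≢l₂ (trans (sym (1+[i-1] l₁)) (trans (cong ℤ.suc e) (1+[i-1] l₂)))))
          (cong (λ y → B 0 (l₁ - + 1) ℤ.* B 0 l₂ + y)
            (cong₂ _+_ crossed (B₀-distinct l₁ l₂ l₁≢l₂))) ⟩
    + 0 + (B 0 (l₁ - + 1) ℤ.* B 0 l₂ + (+ 0))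
      ≡⟨ drop-zeros (B 0 (l₁ - + 1) ℤ.* B 0 l₂) ⟩
    B 0 (l₁ - + 1) ℤ.* B 0 l₂ - + 0
      ≡⟨ cong (λ y → B 0 (l₁ - + 1) ℤ.* B 0 l₂ - y) crossed ⟨
    G 0 l₁ l₂ ∎
    where
    crossed : B 0 l₁ ℤ.* B 0 (l₂ - + 1) ≡ + 0
    crossed = B₀-distinct l₁ (l₂ - + 1) λ e → ℤₚ.<⇒≱ (-1< l₂) (subst (l₂ ℤ.≤_) e l₂≤l₁)
    drop-zeros : ∀ x → + 0 + (x + + 0) ≡ x - + 0
    drop-zeros = solve-∀
  go (suc N) (no l₁≢l₂) = begin
    + size (sep-sucᴱ (sepᴱ (+ suc N)) (no l₁≢l₂))
      ≡⟨ branches (suc N) l₁≢l₂ ⟩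
    _
      ≡⟨ cong₂ _+_ (size-sep N {l₁ - + 1} {l₂ - + 1} (ℤₚ.≤-trans (-1≤ l₂) l₂≤l₁-1))
          (cong₂ _+_ (size-sep N {l₁ - + 1} l₂≤l₁-1)
          (cong₂ _+_ (size-sep N {_} {l₂ - + 1} (ℤₚ.≤-trans (-1≤ l₂) l₂≤l₁))
                     (size-sep N l₂≤l₁))) ⟩
    _
      ≡⟨ G-suc N l₁ l₂ ⟨
    G (suc N) l₁ l₂ ∎
    where
    l₂≤l₁-1 : l₂ ℤ.≤ l₁ - + 1
    l₂≤l₁-1 = <⇒≤-1 (ℤₚ.≤∧≢⇒< l₂≤l₁ (l₁≢l₂ ∘ sym))

-- For `z` positive this is the closed form of the determinant. For `z` zero or negative both sides
-- are 0: the empty walk has equal counts, and on the right the value of `//` at 0 or the binomials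
-- vanish.
fromℕ-size-sep : ∀ z {l₁ l₂} → l₂ ℤ.< l₁ →
  fromℕ (size (sepᴱ z l₁ l₂)) ≡ (l₁ - l₂) // z * fromℕ (binom z l₁) * fromℕ (binom z l₂)
fromℕ-size-sep (+ suc N) {l₁} {l₂} l₂<l₁ = quotient-formula N (l₁ - l₂) (binom (+ suc N) l₁)
  (binom (+ suc N) l₂) _
  (trans (cong (+ suc N ℤ.*_) (size-sep N (ℤₚ.<⇒≤ l₂<l₁))) (G-closed N l₁ l₂))
fromℕ-size-sep (+ zero) {l₁} {l₂} l₂<l₁ = trans
  (cong fromℕ (ℤₚ.+-injective (trans (size-sep-zero (l₁ ℤ.≟ + 0) (l₂ ℤ.≟ + 0))
    (B₀-distinct l₁ l₂ (ℤₚ.<⇒≢ l₂<l₁ ∘ sym)))))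
  (sym (trans (cong (_* fromℕ (binom (+ 0) l₂)) (ℚₚ.*-zeroˡ (fromℕ (binom (+ 0) l₁))))
    (ℚₚ.*-zeroˡ (fromℕ (binom (+ 0) l₂)))))
fromℕ-size-sep -[1+ N ] {l₁} {l₂} l₂<l₁ = sym (ℚₚ.*-zeroʳ ((l₁ - l₂) // -[1+ N ] * 0ℚ))

-- Factorisations of lists

map-split : ∀ (f : X → Y) x u {v} → map f x ≡ u ++ v →
            ∃₂ λ p q → x ≡ p ++ q × map f p ≡ u × map f q ≡ v
map-split f x       []      e = [] , x , refl , refl , e
map-split f (s ∷ x) (c ∷ u) e
  with p , q , x≡ , p≡ , q≡ ← map-split f x u (Listₚ.∷-injectiveʳ e) =
  s ∷ p , q , cong (s ∷_) x≡ , cong₂ _∷_ (Listₚ.∷-injectiveˡ e) p≡ , q≡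

++-cancel-length : ∀ {p q p′ q′ : List X} → p ++ q ≡ p′ ++ q′ → length p ≡ length p′ →
  p ≡ p′ × q ≡ q′
++-cancel-length {p = []}    {p′ = []}     e _ = refl , e
++-cancel-length {p = x ∷ p} {p′ = _ ∷ p′} e l
  with refl , e′ ← Listₚ.∷-injective e
  with p≡ , q≡ ← ++-cancel-length {p = p} {p′ = p′} e′ (ℕₚ.suc-injective l) = cong (x ∷_) p≡ , q≡

++-length≡⇒[] : ∀ (p : List X) {q} → length p ≡ length (p ++ q) → q ≡ []
++-length≡⇒[] []      {[]} _ = refl
++-length≡⇒[] (_ ∷ p) e = ++-length≡⇒[] p (ℕₚ.suc-injective e)

length≡0 : ∀ {x : List X} → length x ≡ 0 → x ≡ []
length≡0 {x = []} _ = refl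

walk-ext : ∀ {x y : Walk} → map proj₁ x ≡ map proj₁ y → map proj₂ x ≡ map proj₂ y → x ≡ y
walk-ext {[]}    {[]}    _ _ = refl
walk-ext {_ ∷ _} {_ ∷ _} e f = cong₂ _∷_
  (cong₂ _,_ (Listₚ.∷-injectiveˡ e) (Listₚ.∷-injectiveˡ f))
  (walk-ext (Listₚ.∷-injectiveʳ e) (Listₚ.∷-injectiveʳ f))

pair-up : ∀ (u v : Word) → length u ≡ length v → ∃ λ x → map proj₁ x ≡ u × map proj₂ x ≡ v
pair-up []      []      _ = [] , refl , refl
pair-up (c ∷ u) (d ∷ v) e with x , u≡ , v≡ ← pair-up u v (ℕₚ.suc-injective e) =
  (c , d) ∷ x , cong (c ∷_) u≡ , cong (d ∷_) v≡

-- Points of a lattice path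

_⊕_ : Point → Word → Point
(x , y) ⊕ w = x + + ∣ w ∣[ a ] , y + + ∣ w ∣[ b ]

⊕-[] : ∀ A → A ⊕ [] ≡ A
⊕-[] A = cong₂ _,_ (ℤₚ.+-identityʳ (proj₁ A)) (ℤₚ.+-identityʳ (proj₂ A))

⊕-∷ : ∀ A c w → move c A ⊕ w ≡ A ⊕ (c ∷ w)
⊕-∷ A a w = cong (_, proj₂ A + + ∣ w ∣[ b ]) (ℤₚ.+-assoc (proj₁ A) (+ 1) (+ ∣ w ∣[ a ]))
⊕-∷ A b w = cong (proj₁ A + + ∣ w ∣[ a ] ,_) (ℤₚ.+-assoc (proj₂ A) (+ 1) (+ ∣ w ∣[ b ]))

last-pathFrom : ∀ A w → last (pathFrom A w) ≡ just (A ⊕ w)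
last-pathFrom A []          = cong just (sym (⊕-[] A))
last-pathFrom A (c ∷ [])    = trans (last-pathFrom (move c A) []) (cong just (⊕-∷ A c []))
last-pathFrom A (c ∷ d ∷ w) = trans (last-pathFrom (move c A) (d ∷ w)) (cong just (⊕-∷ A c (d ∷ w)))

∈-pathFrom⁺ : ∀ A p q → A ⊕ p ∈ pathFrom A (p ++ q)
∈-pathFrom⁺ A []      []      = here (⊕-[] A)
∈-pathFrom⁺ A []      (_ ∷ _) = here (⊕-[] A)
∈-pathFrom⁺ A (c ∷ p) q       =
  there (subst (_∈ pathFrom (move c A) (p ++ q)) (⊕-∷ A c p) (∈-pathFrom⁺ (move c A) p q))

∈-pathFrom⁻ : ∀ A w {P} → P ∈ pathFrom A w → ∃₂ λ p q → w ≡ p ++ q × P ≡ A ⊕ p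
∈-pathFrom⁻ A []      (here refl) = [] , [] , refl , sym (⊕-[] A)
∈-pathFrom⁻ A (c ∷ w) (here refl) = [] , c ∷ w , refl , sym (⊕-[] A)
∈-pathFrom⁻ A (c ∷ w) (there P∈)
  with p , q , w≡ , P≡ ← ∈-pathFrom⁻ (move c A) w P∈ = c ∷ p , q , cong (c ∷_) w≡ ,
    trans P≡ (⊕-∷ A c p)

-- The point with abscissa `m` on the antidiagonal x + y = `t`, which is the form of all points A in
-- the theorem. Each step of a path raises the level `t` by one.
diag : ℤ → ℤ → Point
diag t m = m , t - m

diag-⊕ : ∀ t m w → diag t m ⊕ w ≡ diag (t + + length w) (m + + ∣ w ∣[ a ])
diag-⊕ t m w = cong (m + + ∣ w ∣[ a ] ,_) (begin
  t - m + + ∣ w ∣[ b ]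
    ≡⟨ rearrange t m (+ ∣ w ∣[ a ]) (+ ∣ w ∣[ b ]) ⟩
  t + (+ ∣ w ∣[ a ] + + ∣ w ∣[ b ]) - (m + + ∣ w ∣[ a ])
    ≡⟨ cong (λ k → t + + k - (m + + ∣ w ∣[ a ])) (length-letters w) ⟨
  t + + length w - (m + + ∣ w ∣[ a ]) ∎)
  where
  open ≡-Reasoning
  rearrange : ∀ t m x y → t - m + y ≡ t + (x + y) - (m + x)
  rearrange = solve-∀

diag-level : ∀ {t t′ m m′} → diag t m ≡ diag t′ m′ → t ≡ t′
diag-level {t} {t′} {m} {m′} e = trans (sym (total t m))
  (trans (cong₂ _+_ (cong proj₁ e) (cong proj₂ e)) (total t′ m′))
  where
  total : ∀ t m → m + (t - m) ≡ t
  total = solve-∀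

+-cancelˡ-≡ : ∀ s {x y} → s + x ≡ s + y → x ≡ y
+-cancelˡ-≡ s {x} {y} e = trans (sym (+-minus s x)) (trans (cong (_- s) e) (+-minus s y))

module _ (s : ℤ) (l l′ : ℤ) (x : Walk) where

  -- The two starting abscissas are free because both intersections in `𝒩` are treated this way:
  -- with `l₁`, `l₂` for p ∩ q, and with `l₁` twice for q ∩ p′.
  meet⁺ : ∀ p q → x ≡ p ++ q → l + + #₁ p ≡ l′ + + #₂ p → ∃ λ P →
          P ∈ pathFrom (diag s l) (map proj₁ x) × P ∈ pathFrom (diag s l′) (map proj₂ x) ×
          P ≡ diag (s + + length p) (l + + #₁ p)
  meet⁺ p q refl e = diag s l ⊕ map proj₁ p ,
    subst (λ w → diag s l ⊕ map proj₁ p ∈ pathFrom (diag s l) w)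
      (sym (Listₚ.map-++ proj₁ p q)) (∈-pathFrom⁺ (diag s l) (map proj₁ p) (map proj₁ q)) ,
    subst₂ (λ P w → P ∈ pathFrom (diag s l′) w)
      (trans (diag-⊕ s l′ (map proj₂ p)) (trans
        (cong₂ (λ k m → diag (s + + k) m) (trans (Listₚ.length-map proj₂ p)
        (sym (Listₚ.length-map proj₁ p))) (sym e)) (sym (diag-⊕ s l (map proj₁ p)))))
      (sym (Listₚ.map-++ proj₂ p q)) (∈-pathFrom⁺ (diag s l′) (map proj₂ p) (map proj₂ q)) ,
    trans (diag-⊕ s l (map proj₁ p)) (cong (λ k → diag (s + + k) (l + + #₁ p))
      (Listₚ.length-map proj₁ p))

  -- The level of a common point fixes how many steps lead to it on either path, so both paths reach
  -- it at one cut of the walk.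
  meet⁻ : ∀ {P} → P ∈ pathFrom (diag s l) (map proj₁ x) → P ∈ pathFrom (diag s l′) (map proj₂ x) →
          ∃₂ λ p q → x ≡ p ++ q × l + + #₁ p ≡ l′ + + #₂ p × P ≡ diag (s + + length p) (l + + #₁ p)
  meet⁻ P∈ P∈′
    with u , _ , u++ , refl ← ∈-pathFrom⁻ (diag s l) _ P∈
       | v , _ , v++ , P≡   ← ∈-pathFrom⁻ (diag s l′) _ P∈′
    with p , q , x≡ , refl , _ ← map-split proj₁ x u u++
       | p′ , q′ , x≡′ , refl , _ ← map-split proj₂ x v v++
    with e ← trans (sym (diag-⊕ s l (map proj₁ p))) (trans P≡ (diag-⊕ s l′ (map proj₂ p′)))
    with refl , _ ← ++-cancel-length {p = p} {p′ = p′} (trans (sym x≡) x≡′)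
           (trans (sym (Listₚ.length-map proj₁ p))
             (trans (ℤₚ.+-injective (+-cancelˡ-≡ s (diag-level e))) (Listₚ.length-map proj₂ p′)))
    = p , q , x≡ , cong proj₁ e ,
      trans (diag-⊕ s l (map proj₁ p)) (cong (λ k → diag (s + + k) (l + + #₁ p))
        (Listₚ.length-map proj₁ p))

-- The overlap x₂ as a triple of lattice paths

-- The inequality with offsets forbids meetings before the end, the start included;
-- `NoBalancedPrefix` forbids meetings after the start once both paths begin at one point.
Mid : ℕ → ℤ → ℤ → ℤ → Walk → Set
Mid g l₁ l₂ k x = length x ≡ g × l₁ + + #₁ x ≡ k × l₂ + + #₂ x ≡ k ×
  (∀ p q → x ≡ p ++ q → q ≢ [] → l₁ + + #₁ p ≢ l₂ + + #₂ p) × NoBalancedPrefix x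

module _ (s j l₁ l₂ k : ℤ) (g : ℕ) (j≡ : j ≡ s + + g) where

  private
    -- In the theorem A is A_{l₂} and B is A_{l₁}, so p spells the second word and q the first.
    toPaths : Walk → List Point × List Point × List Point
    toPaths x = pathFrom (diag s l₂) (map proj₂ x) , pathFrom (diag s l₁) (map proj₁ x) ,
                pathFrom (diag s l₁) (map proj₂ x)

    path : ∀ {A C} w → A ⊕ w ≡ C → LatticePath A C (pathFrom A w)
    path {A} w e = record
      { steps = proj₁ (pathFrom-linked A w) ; starts = pathFrom-head A w ; ends =
        trans (last-pathFrom A w) (cong just e) }

    end : ∀ {l} w → length w ≡ g → l + + ∣ w ∣[ a ] ≡ k → diag s l ⊕ w ≡ diag j k
    end w refl refl = trans (diag-⊕ s _ w) (cong (λ t → diag t _) (sym j≡))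

    maps : ∀ {x} → Mid g l₁ l₂ k x → 𝒩 (diag s l₂) (diag s l₁) (diag j k) (toPaths x)
    maps {x} (length-x , k≡₁ , k≡₂ , apart , nbp) =
      path (map proj₂ x) end₂ , path (map proj₁ x) end₁ ,
      cong (pathFrom (diag s l₁)) (sym (proj₂ (pathFrom-linked (diag s l₂) (map proj₂ x)))) ,
      ((λ (P∈ , P∈′) → only-end P∈ P∈′) ,
       λ { refl → end∈ l₂ (map proj₂ x) end₂ , end∈ l₁ (map proj₁ x) end₁ }) ,
      ((λ (P∈ , P∈′) → only-start P∈ P∈′) ,
       λ { refl → start∈ (map proj₁ x) , start∈ (map proj₂ x) })
      where
      end₁ = end (map proj₁ x) (trans (Listₚ.length-map proj₁ x) length-x) k≡₁
      end₂ = end (map proj₂ x) (trans (Listₚ.length-map proj₂ x) length-x) k≡₂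

      only-end : ∀ {P} → P ∈ pathFrom (diag s l₂) (map proj₂ x) →
        P ∈ pathFrom (diag s l₁) (map proj₁ x) → diag j k ≡ P
      only-end P∈ P∈′ with meet⁻ s l₁ l₂ x P∈′ P∈
      ... | p , _ ∷ _ , x≡ , e , _ = contradiction e (apart p _ x≡ λ ())
      ... | p , [] , x≡ , e , P≡ with refl ← trans x≡ (Listₚ.++-identityʳ p) =
        sym (trans P≡ (cong₂ diag (trans (cong (λ t → s + + t) length-x) (sym j≡)) k≡₁))

      only-start : ∀ {P} → P ∈ pathFrom (diag s l₁) (map proj₁ x) →
        P ∈ pathFrom (diag s l₁) (map proj₂ x) → diag s l₁ ≡ P
      only-start P∈ P∈′ with meet⁻ s l₁ l₁ x P∈ P∈′
      ... | [] , _ , _ , _ , P≡ = sym (trans P≡ (cong₂ diag (ℤₚ.+-identityʳ s) (ℤₚ.+-identityʳ l₁)))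
      ... | p@(_ ∷ _) , q , x≡ , e , _ = contradiction (ℤₚ.+-injective (+-cancelˡ-≡ l₁ e))
        (nbp p q x≡ λ ())

      end∈ : ∀ l w → diag s l ⊕ w ≡ diag j k → diag j k ∈ pathFrom (diag s l) w
      end∈ l w e = subst₂ (λ P v → P ∈ pathFrom (diag s l) v) e (Listₚ.++-identityʳ w)
        (∈-pathFrom⁺ (diag s l) w [])

      start∈ : ∀ w → diag s l₁ ∈ pathFrom (diag s l₁) w
      start∈ w = subst (_∈ pathFrom (diag s l₁) w) (⊕-[] (diag s l₁)) (∈-pathFrom⁺ (diag s l₁) [] w)

    unmaps : ∀ x → diag j k ≡ diag s l₂ ⊕ map proj₂ x → diag j k ≡ diag s l₁ ⊕ map proj₁ x →
      (_∈ pathFrom (diag s l₂) (map proj₂ x)) ∩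
        (_∈ pathFrom (diag s l₁) (map proj₁ x)) ≐ ｛ diag j k ｝ →
      (_∈ pathFrom (diag s l₁) (map proj₁ x)) ∩
        (_∈ pathFrom (diag s l₁) (map proj₂ x)) ≐ ｛ diag s l₁ ｝ →
      Mid g l₁ l₂ k x
    unmaps x end₂ end₁ (only-end , _) (only-start , _) = length-x ,
      sym (cong proj₁ end₁) , sym (cong proj₁ end₂) , apart , nbp
      where
      length-x : length x ≡ g
      length-x = sym (ℤₚ.+-injective (+-cancelˡ-≡ s (trans (sym j≡) (trans
        (diag-level (trans end₁ (diag-⊕ s l₁ (map proj₁ x))))
          (cong (λ t → s + + t) (Listₚ.length-map proj₁ x))))))

      apart : ∀ p q → x ≡ p ++ q → q ≢ [] → l₁ + + #₁ p ≢ l₂ + + #₂ p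
      apart p q x≡ q≢ e with P , P∈ , P∈′ , P≡ ← meet⁺ s l₁ l₂ x p q x≡ e =
        q≢ (++-length≡⇒[] p (trans (sym (ℤₚ.+-injective
          (+-cancelˡ-≡ s (trans (sym j≡) (diag-level (trans (only-end (P∈′ , P∈)) P≡))))))
          (trans (sym length-x) (cong length x≡))))

      nbp : NoBalancedPrefix x
      nbp p q x≡ p≢ e with P , P∈ , P∈′ , P≡ ← meet⁺ s l₁ l₁ x p q x≡ (cong (λ t → l₁ + + t) e) =
        p≢ (length≡0 (sym (ℤₚ.+-injective (+-cancelˡ-≡ s
          (trans (ℤₚ.+-identityʳ s) (diag-level (trans (only-start (P∈ , P∈′)) P≡)))))))

    surjective : ∀ {t} → 𝒩 (diag s l₂) (diag s l₁) (diag j k) t → ∃ λ x →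
      Mid g l₁ l₂ k x × toPaths x ≡ t
    surjective (π , ρ , refl , ends , starts) =
      build (word (steps π)) (word (steps ρ)) (linked-pathFrom (steps π) (LatticePath.starts π))
        (linked-pathFrom (steps ρ) (LatticePath.starts ρ)) (LatticePath.ends π)
          (LatticePath.ends ρ) ends starts
      where
      length≡g : ∀ {l} w → diag j k ≡ diag s l ⊕ w → g ≡ length w
      length≡g w e = ℤₚ.+-injective (+-cancelˡ-≡ s
        (trans (sym j≡) (diag-level (trans e (diag-⊕ s _ w)))))

      build : ∀ {p q} w u → p ≡ pathFrom (diag s l₂) w → q ≡ pathFrom (diag s l₁) u →
        last p ≡ just (diag j k) → last q ≡ just (diag j k) →
        (_∈ p) ∩ (_∈ q) ≐ ｛ diag j k ｝ → (_∈ q) ∩ (_∈ pathFrom (diag s l₁) w) ≐ ｛ diag s l₁ ｝ →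
        ∃ λ x → Mid g l₁ l₂ k x × toPaths x ≡ (p , q , pathFrom (diag s l₁) w)
      build w u refl refl last-p last-q ends starts
        with end₂ ← pathFrom-last (diag s l₂) w last-p | end₁ ← pathFrom-last (diag s l₁) u last-q
        with x , refl , refl ← pair-up u w (trans (sym (length≡g u end₁)) (length≡g w end₂))
        = x , unmaps x end₂ end₁ ends starts , refl

  mid-bijection : Bijection (Mid g l₁ l₂ k) (𝒩 (diag s l₂) (diag s l₁) (diag j k))
  mid-bijection = record
    { to         = toPaths
    ; injective  = λ _ _ e → walk-ext (pathFrom-injective (diag s l₁) (cong (proj₁ ∘ proj₂) e))
                                      (pathFrom-injective (diag s l₂) (cong proj₁ e))
    ; maps       = maps
    ; surjective = surjective
    }

  midᴱ : Enumeration (Mid g l₁ l₂ k)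
  midᴱ = pullbackᴱ mid-bijection (𝒩-enumeration (diag s l₂) (diag s l₁) (diag j k))

  size-midᴱ : size midᴱ ≡ ∣𝒩∣ (diag s l₂) (diag s l₁) (diag j k)
  size-midᴱ = size-pullbackᴱ mid-bijection (𝒩-enumeration (diag s l₂) (diag s l₁) (diag j k))

-- Levi's lemma.
++-compare : ∀ (p {q} p′ {q′} : List X) → p ++ q ≡ p′ ++ q′ →
  (∃ λ r → q ≡ r ++ q′ × p′ ≡ p ++ r) ⊎ (∃ λ r → q′ ≡ r ++ q × p ≡ p′ ++ r)
++-compare []      p′       e    = inj₁ (p′ , e , refl)
++-compare (x ∷ p) []       e    = inj₂ (x ∷ p , sym e , refl)
++-compare (x ∷ p) (_ ∷ p′) e with refl , e′ ← Listₚ.∷-injective e with ++-compare p p′ e′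
... | inj₁ (r , q≡ , p′≡) = inj₁ (r , q≡ , cong (x ∷_) p′≡)
... | inj₂ (r , q≡ , p≡)  = inj₂ (r , q≡ , cong (x ∷_) p≡)

++-≢[]ʳ : ∀ (p : List X) {q} → q ≢ [] → p ++ q ≢ []
++-≢[]ʳ p q≢ e = q≢ (Listₚ.++-conicalʳ p _ e)

++-≢[]ˡ : ∀ {p q : List X} → p ≢ [] → p ++ q ≢ []
++-≢[]ˡ p≢ e = p≢ (Listₚ.++-conicalˡ _ _ e)

length-<-++ : ∀ (p : List X) {q} → p ≢ [] → length q ℕ.< length (p ++ q)
length-<-++ []      p≢ = contradiction refl p≢
length-<-++ (x ∷ p) {q} _ = s≤s (subst (length q ℕ.≤_) (sym (Listₚ.length-++ p))
  (ℕₚ.m≤n+m _ (length p)))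

reverse-≢[] : ∀ {p : List X} → p ≢ [] → reverse p ≢ []
reverse-≢[] p≢ e = p≢ (Listₚ.reverse-injective e)

map-≢[] : ∀ (f : X → Y) {p} → p ≢ [] → map f p ≢ []
map-≢[] f {[]}    p≢ _ = p≢ refl
map-≢[] f {_ ∷ _} _  ()

-- Borders as balanced factors of a walk

prefix⇒++ : ∀ {y v : Word} → Prefix _≡_ y v → ∃ λ t → v ≡ y ++ t
prefix⇒++ {v = v} []  = v , refl
prefix⇒++ (refl ∷ p) with t , refl ← prefix⇒++ p = t , refl

++⇒prefix : ∀ (y t : Word) → Prefix _≡_ y (y ++ t)
++⇒prefix []      t = []
++⇒prefix (c ∷ y) t = refl ∷ ++⇒prefix y t

suffix⇒++ : ∀ {y v : Word} → Suffix _≡_ y v → ∃ λ t → v ≡ t ++ y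
suffix⇒++ (here e)  = [] , sym (Pointwise-≡⇒≡ e)
suffix⇒++ {v = c ∷ _} (there s) with t , refl ← suffix⇒++ s = c ∷ t , refl

++⇒suffix : ∀ (t y : Word) → Suffix _≡_ y (t ++ y)
++⇒suffix []      y = here (≡⇒Pointwise-≡ refl)
++⇒suffix (c ∷ t) y = there (++⇒suffix t y)

∼⇒length≡ : ∀ x y → x ∼ y → length x ≡ length y
∼⇒length≡ x y x∼y = trans (length-letters x) (trans (cong₂ ℕ._+_ (x∼y a) (x∼y b))
  (sym (length-letters y)))

balanced⇒∼ : ∀ x → Balanced x → map proj₁ x ∼ map proj₂ x
balanced⇒∼ x e a = e
balanced⇒∼ x e b = ℕₚ.+-cancelˡ-≡ (#₁ x) _ _ (begin
  #₁ x ℕ.+ ∣ map proj₁ x ∣[ b ]  ≡⟨ length-letters (map proj₁ x) ⟨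
  length (map proj₁ x)           ≡⟨ Listₚ.length-map proj₁ x ⟩
  length x                       ≡⟨ Listₚ.length-map proj₂ x ⟨
  length (map proj₂ x)           ≡⟨ length-letters (map proj₂ x) ⟩
  #₂ x ℕ.+ ∣ map proj₂ x ∣[ b ]  ≡⟨ cong (ℕ._+ ∣ map proj₂ x ∣[ b ]) e ⟨
  #₁ x ℕ.+ ∣ map proj₂ x ∣[ b ]  ∎)
  where open ≡-Reasoning

toWords : Walk → Word × Word
toWords x = map proj₁ x , reverse (map proj₂ x)

BalancedSuffix : Walk → Walk → Set
BalancedSuffix x q = (∃ λ p → x ≡ p ++ q × p ≢ []) × q ≢ [] × Balanced q

-- Reversal turns the prefix `y` into a suffix of the second component. Abelian equivalent words
-- have equal length, so both suffixes cut the walk at the same place.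
internalBorder⇒ : ∀ {x s y} → InternalBorder (map proj₁ x) (reverse (map proj₂ x)) (s , y) →
                  ∃ λ q → BalancedSuffix x q × length q ≡ length s
internalBorder⇒ {x} {s} {y} (s≢[] , (suffix , s≢u) , (prefix , _) , s∼y)
  with u′ , u≡ ← suffix⇒++ suffix | v′ , v≡ ← prefix⇒++ prefix
  with p , q , refl , p≡ , q≡ ← map-split proj₁ x u′ u≡
  with p₂ , q₂ , x≡ , _ , q₂≡ ← map-split proj₂ (p ++ q) (reverse v′) {reverse y}
    (trans (sym (Listₚ.reverse-involutive _)) (trans (cong reverse v≡) (Listₚ.reverse-++ y v′)))
  = q , ((p , refl , λ { refl → s≢u (trans (sym q≡) refl) }) , (λ { refl → s≢[] (sym q≡) }) ,
    balanced) , length-q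
  where
  length-q : length q ≡ length s
  length-q = trans (sym (Listₚ.length-map proj₁ q)) (cong length q≡)

  length-q₂ : length q ≡ length q₂
  length-q₂ = begin
    length q              ≡⟨ length-q ⟩
    length s              ≡⟨ ∼⇒length≡ s y s∼y ⟩
    length y              ≡⟨ Listₚ.length-reverse y ⟨
    length (reverse y)    ≡⟨ cong length q₂≡ ⟨
    length (map proj₂ q₂) ≡⟨ Listₚ.length-map proj₂ q₂ ⟩
    length q₂             ∎
    where open ≡-Reasoning

  length-p : length p ≡ length p₂
  length-p = ℕₚ.+-cancelʳ-≡ (length q) _ _ (trans (sym (Listₚ.length-++ p))
    (trans (cong length x≡) (trans (Listₚ.length-++ p₂) (cong (length p₂ ℕ.+_) (sym length-q₂)))))

  balanced : Balanced q
  balanced = begin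
    #₁ q                       ≡⟨ cong ∣_∣[ a ] q≡ ⟩
    ∣ s ∣[ a ]                 ≡⟨ s∼y a ⟩
    ∣ y ∣[ a ]                 ≡⟨ ∣reverse∣ y a ⟨
    ∣ reverse y ∣[ a ]         ≡⟨ cong ∣_∣[ a ] q₂≡ ⟨
    #₂ q₂                      ≡⟨ cong #₂ (proj₂ (++-cancel-length {p = p} {p′ = p₂} x≡ length-p)) ⟨
    #₂ q                       ∎
    where open ≡-Reasoning

⇒internalBorder : ∀ {x q} → BalancedSuffix x q →
  InternalBorder (map proj₁ x) (reverse (map proj₂ x)) (toWords q)
⇒internalBorder {q = q} ((p , refl , p≢[]) , q≢[] , balanced) =
  map-≢[] proj₁ q≢[] ,
  (subst (Suffix _≡_ (map proj₁ q)) (sym (Listₚ.map-++ proj₁ p q))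
    (++⇒suffix (map proj₁ p) (map proj₁ q)) ,
   λ e → ℕₚ.<⇒≢ (length-<-++ p p≢[]) (trans (sym (Listₚ.length-map proj₁ q))
     (trans (cong length e) (Listₚ.length-map proj₁ (p ++ q))))) ,
  (subst (Prefix _≡_ (reverse (map proj₂ q)))
    (sym (trans (cong reverse (Listₚ.map-++ proj₂ p q))
    (Listₚ.reverse-++ (map proj₂ p) (map proj₂ q))))
    (++⇒prefix (reverse (map proj₂ q)) (reverse (map proj₂ p))) ,
   λ e → ℕₚ.<⇒≢ (length-<-++ p p≢[]) (trans (sym (Listₚ.length-map proj₂ q))
     (trans (cong length (Listₚ.reverse-injective {x = map proj₂ q} {map proj₂ (p ++ q)} e))
       (Listₚ.length-map proj₂ (p ++ q))))) ,
  λ c → trans (balanced⇒∼ q balanced c) (sym (∣reverse∣ (map proj₂ q) c))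

ShortestBalancedSuffix : Walk → ℕ → Set
ShortestBalancedSuffix x i =
  (∃ λ q → BalancedSuffix x q × length q ≡ i) × (∀ q → BalancedSuffix x q → i ℕ.≤ length q)

lsb⇒ : ∀ {x i} → Lsb (map proj₁ x) (reverse (map proj₂ x)) i → ShortestBalancedSuffix x i
lsb⇒ {x} (_ , (border , minimal) , refl) = internalBorder⇒ {x} border ,
  λ q bs → subst (_ ℕ.≤_) (Listₚ.length-map proj₁ q) (minimal _ (⇒internalBorder bs))

⇒lsb : ∀ {x i} → ShortestBalancedSuffix x i → Lsb (map proj₁ x) (reverse (map proj₂ x)) i
⇒lsb {x} ((q , bs , refl) , minimal) = toWords q ,
  (⇒internalBorder bs , λ _ border → let q′ , bs′ , length-q′ = internalBorder⇒ {x} border in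
    subst₂ ℕ._≤_ (sym (Listₚ.length-map proj₁ q)) length-q′ (minimal q′ bs′)) ,
  Listₚ.length-map proj₁ q

-- The mirror symmetry between prefixes and suffixes

exchange : Letter × Letter → Letter × Letter
exchange = swap

-- The walk of (v , u) when the given one is the walk of (u , v). It carries every fact about
-- suffixes and lsb(u,v) over to prefixes and lsb(v,u).
mirror : Walk → Walk
mirror x = reverse (map exchange x)

mirror-++ : ∀ p q → mirror (p ++ q) ≡ mirror q ++ mirror p
mirror-++ p q = trans (cong reverse (Listₚ.map-++ exchange p q))
  (Listₚ.reverse-++ (map exchange p) (map exchange q))

map-swap-involutive : ∀ x → map exchange (map exchange x) ≡ x
map-swap-involutive x = trans (sym (Listₚ.map-∘ x)) (Listₚ.map-id x)

mirror-involutive : ∀ x → mirror (mirror x) ≡ x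
mirror-involutive x = begin
  reverse (map exchange (reverse (map exchange x)))  ≡⟨ cong reverse
    (Listₚ.reverse-map exchange (map exchange x)) ⟩
  reverse (reverse (map exchange (map exchange x)))  ≡⟨ Listₚ.reverse-involutive _ ⟩
  map exchange (map exchange x)                      ≡⟨ map-swap-involutive x ⟩
  x                                          ∎
  where open ≡-Reasoning

length-mirror : ∀ x → length (mirror x) ≡ length x
length-mirror x = trans (Listₚ.length-reverse (map exchange x)) (Listₚ.length-map exchange x)

#₁-swap : ∀ x → #₁ (map exchange x) ≡ #₂ x
#₁-swap x = cong ∣_∣[ a ] (sym (Listₚ.map-∘ x))

#₂-swap : ∀ x → #₂ (map exchange x) ≡ #₁ x
#₂-swap x = cong ∣_∣[ a ] (sym (Listₚ.map-∘ x))

balanced-swap : ∀ x → Balanced x → Balanced (map exchange x)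
balanced-swap x e = trans (#₁-swap x) (trans (sym e) (sym (#₂-swap x)))

balanced-reverse : ∀ x → Balanced x → Balanced (reverse x)
balanced-reverse x e = trans (#₁-reverse x) (trans e (sym (#₂-reverse x)))

balanced-mirror : ∀ x → Balanced x → Balanced (mirror x)
balanced-mirror x e = balanced-reverse (map exchange x) (balanced-swap x e)

mirror-≢[] : ∀ {x} → x ≢ [] → mirror x ≢ []
mirror-≢[] x≢[] = reverse-≢[] (map-≢[] exchange x≢[])

toWords-mirror : ∀ x → (map proj₁ (mirror x) , reverse (map proj₂ (mirror x))) ≡ swap (toWords x)
toWords-mirror x = cong₂ _,_
  (trans (Listₚ.reverse-map proj₁ (map exchange x)) (cong reverse (sym (Listₚ.map-∘ x))))
  (trans (cong reverse (trans (Listₚ.reverse-map proj₂ (map exchange x))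
    (cong reverse (sym (Listₚ.map-∘ x)))))
    (Listₚ.reverse-involutive (map proj₁ x)))

BalancedPrefix : Walk → Walk → Set
BalancedPrefix x p = (∃ λ q → x ≡ p ++ q × q ≢ []) × p ≢ [] × Balanced p

ShortestBalancedPrefix : Walk → ℕ → Set
ShortestBalancedPrefix x j =
  (∃ λ p → BalancedPrefix x p × length p ≡ j) × (∀ p → BalancedPrefix x p → j ℕ.≤ length p)

mirror-suffix : ∀ {x q} → BalancedSuffix (mirror x) q → BalancedPrefix x (mirror q)
mirror-suffix {x} {q} ((p , x≡ , p≢[]) , q≢[] , balanced) =
  (mirror p , trans (sym (mirror-involutive x)) (trans (cong mirror x≡) (mirror-++ p q)) ,
    mirror-≢[] p≢[]) ,
  mirror-≢[] q≢[] , balanced-mirror q balanced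

mirror-prefix : ∀ {x p} → BalancedPrefix x p → BalancedSuffix (mirror x) (mirror p)
mirror-prefix {x} {p} ((q , refl , q≢[]) , p≢[] , balanced) =
  (mirror q , mirror-++ p q , mirror-≢[] q≢[]) , mirror-≢[] p≢[] , balanced-mirror p balanced

lsb′⇒ : ∀ {x j} → Lsb (reverse (map proj₂ x)) (map proj₁ x) j → ShortestBalancedPrefix x j
lsb′⇒ {x} lsb with subst (λ (v , u) → Lsb v u _) (sym (toWords-mirror x)) lsb
... | lsb₂ with (q , bs , refl) , minimal ← lsb⇒ {mirror x} lsb₂ =
  (mirror q , mirror-suffix bs , length-mirror q) ,
  λ p bp → subst (_ ℕ.≤_) (length-mirror p) (minimal (mirror p) (mirror-prefix bp))

⇒lsb′ : ∀ {x j} → ShortestBalancedPrefix x j → Lsb (reverse (map proj₂ x)) (map proj₁ x) j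
⇒lsb′ {x} ((p , bp , refl) , minimal) = subst (λ (v , u) → Lsb v u _) (toWords-mirror x)
  (⇒lsb {mirror x}
  ((mirror p , mirror-prefix bp , length-mirror p) ,
   λ q bs → subst (_ ℕ.≤_) (length-mirror q) (minimal (mirror q) (mirror-suffix bs))))

-- Overlap decomposition

Triple : Set
Triple = Walk × Walk × Walk

join : Triple → Walk
join (x₁ , x₂ , x₃) = x₁ ++ x₂ ++ x₃

-- The parts x₁ and x₃ are nonempty because borders are proper. Minimality needs testing only inside
-- x₁ x₂ and x₂ x₃: any other balanced prefix or suffix of the walk is at least as long.
Split : ℕ → ℕ → Triple → Set
Split n g (x₁ , x₂ , x₃) =
  length (x₁ ++ x₂ ++ x₃) ≡ n × length x₂ ≡ g × x₁ ≢ [] × x₃ ≢ [] ×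
  Balanced (x₁ ++ x₂) × Balanced (x₂ ++ x₃) ×
  (∀ p q → x₁ ++ x₂ ≡ p ++ q → p ≢ [] → q ≢ [] → ¬ Balanced p) ×
  (∀ p q → x₂ ++ x₃ ≡ p ++ q → p ≢ [] → q ≢ [] → ¬ Balanced q)

excess⇒ : ∀ i j {n g} → + i + + j - + n ≡ + g → i ℕ.+ j ≡ n ℕ.+ g
excess⇒ i j {n} e = ℤₚ.+-injective (minus-+ {+ n} {+ (i ℕ.+ j)} e)

⇒excess : ∀ i j {n g} → i ℕ.+ j ≡ n ℕ.+ g → + i + + j - + n ≡ + g
⇒excess i j {n} e = trans (cong (λ t → + t - + n) e) (+-minus (+ n) _)

overlap-length : ∀ (x₁ x₂ x₃ : List X) →
  length (x₂ ++ x₃) ℕ.+ length (x₁ ++ x₂) ≡ length (x₁ ++ x₂ ++ x₃) ℕ.+ length x₂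
overlap-length x₁ x₂ x₃
  rewrite Listₚ.length-++ x₁ {x₂ ++ x₃} | Listₚ.length-++ x₁ {x₂} | Listₚ.length-++ x₂ {x₃} =
  count-twice (length x₁) (length x₂) (length x₃)
  where
  count-twice : ∀ k l m → (l ℕ.+ m) ℕ.+ (k ℕ.+ l) ≡ (k ℕ.+ (l ℕ.+ m)) ℕ.+ l
  count-twice = ℕ-Solver.solve-∀

split⇒mab : ∀ {n g t} → Split n g t → MABWithExcess n g (toWords (join t))
split⇒mab {n} {g} {x₁ , x₂ , x₃} (length-x , length-x₂ , x₁≢[] , x₃≢[] , bal₁₂ , bal₂₃ , min₁₂ ,
  min₂₃) =
  trans (Listₚ.length-map proj₁ x) length-x ,
  trans (Listₚ.length-reverse (map proj₂ x)) (trans (Listₚ.length-map proj₂ x) length-x) ,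
  mab I J ,
  (length (x₂ ++ x₃) , length (x₁ ++ x₂)) , I , J ,
  ⇒excess (length (x₂ ++ x₃)) (length (x₁ ++ x₂))
    (trans (overlap-length x₁ x₂ x₃) (cong₂ ℕ._+_ length-x length-x₂))
  where
  x = x₁ ++ x₂ ++ x₃

  -- An internal border of (v , u) with its components exchanged is an external border of (u , v).
  mab : ∀ {u v i j} → Lsb u v i → Lsb v u j → MAB u v
  mab (_ , (internal , _) , _) ((s , y) , ((s≢[] , suffix , prefix , s∼y) , _) , _) =
    (_ , internal) ,
    (y , s) , (λ { refl → s≢[] (length≡0 (∼⇒length≡ s [] s∼y)) }) , prefix , suffix , λ c →
      sym (s∼y c)

  I : Lsb (map proj₁ x) (reverse (map proj₂ x)) (length (x₂ ++ x₃))
  I = ⇒lsb {x} ((x₂ ++ x₃ , ((x₁ , refl , x₁≢[]) , ++-≢[]ʳ x₂ x₃≢[] , bal₂₃) , refl) , minimal)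
    where
    minimal : ∀ q → BalancedSuffix x q → length (x₂ ++ x₃) ℕ.≤ length q
    minimal q ((p , x≡ , _) , q≢[] , bal) with ++-compare x₁ p x≡
    ... | inj₁ ([] , e , _)        = ℕₚ.≤-reflexive (cong length e)
    ... | inj₁ (r@(_ ∷ _) , e , _) = contradiction bal (min₂₃ r q e (λ ()) q≢[])
    ... | inj₂ (r , refl , _)      = Listₚ.length-++-≤ʳ (x₂ ++ x₃) {r}

  J : Lsb (reverse (map proj₂ x)) (map proj₁ x) (length (x₁ ++ x₂))
  J = ⇒lsb′ {x} ((x₁ ++ x₂ , ((x₃ , sym (Listₚ.++-assoc x₁ x₂ x₃) , x₃≢[]) , ++-≢[]ˡ x₁≢[] , bal₁₂)
    , refl) , minimal)
    where
    minimal : ∀ p → BalancedPrefix x p → length (x₁ ++ x₂) ℕ.≤ length p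
    minimal p ((q , x≡ , _) , p≢[] , bal) with ++-compare (x₁ ++ x₂) p
      (trans (Listₚ.++-assoc x₁ x₂ x₃) x≡)
    ... | inj₁ (r , _ , refl)      = Listₚ.length-++-≤ˡ (x₁ ++ x₂)
    ... | inj₂ ([] , _ , e)        = ℕₚ.≤-reflexive (cong length (trans e (Listₚ.++-identityʳ p)))
    ... | inj₂ (r@(_ ∷ _) , _ , e) = contradiction bal (min₁₂ p r e p≢[] λ ())

mab⇒split : ∀ {n g uv} → 0 ℕ.< g → MABWithExcess n g uv → ∃ λ t →
  Split n g t × toWords (join t) ≡ uv
mab⇒split {n} {g} {u , v} 0<g (length-u , length-v , _ , (i , j) , I , J , excess)
  with x , refl , v≡ ← pair-up u (reverse v) (trans length-u
    (trans (sym length-v) (sym (Listₚ.length-reverse v))))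
  with refl ← trans (sym (Listₚ.reverse-involutive v)) (cong reverse (sym v≡))
  with (q , ((p , x≡ , p≢[]) , q≢[] , bal-q) , refl) , min-q ← lsb⇒ {x} I
     | (p′ , ((q′ , x≡′ , q′≢[]) , p′≢[] , bal-p′) , refl) , min-p′ ← lsb′⇒ {x} J
  = assemble (++-compare p p′ (trans (sym x≡) x≡′))
  where
  length-x : length x ≡ n
  length-x = trans (sym (Listₚ.length-map proj₁ x)) length-u

  lengths : length q ℕ.+ length p′ ≡ n ℕ.+ g
  lengths = excess⇒ (length q) (length p′) excess

  assemble : (∃ λ r → q ≡ r ++ q′ × p′ ≡ p ++ r) ⊎ (∃ λ r → q′ ≡ r ++ q × p ≡ p′ ++ r) →
             ∃ λ t → Split n g t × toWords (join t) ≡ toWords x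
  assemble (inj₁ (r , refl , refl)) = (p , r , q′) ,
    (trans (cong length (sym x≡)) length-x ,
     ℕₚ.+-cancelˡ-≡ n _ _ (trans (cong (ℕ._+ length r) (trans (sym length-x) (cong length x≡)))
       (trans (sym (overlap-length p r q′)) lengths)) ,
     p≢[] , q′≢[] , bal-p′ , bal-q ,
     (λ s t e s≢[] t≢[] bal → ℕₚ.<⇒≱
       (subst (length s ℕ.<_) (trans (Listₚ.length-++-comm t s) (sym (cong length e)))
         (length-<-++ t t≢[]))
       (min-p′ s ((t ++ q′ , trans x≡′ (trans (cong (_++ q′) e) (Listₚ.++-assoc s t q′)) ,
         ++-≢[]ˡ t≢[]) , s≢[] , bal))) ,
     (λ s t e s≢[] t≢[] bal → ℕₚ.<⇒≱
       (subst (length t ℕ.<_) (sym (cong length e)) (length-<-++ s s≢[]))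
       (min-q t ((p ++ s , trans x≡ (trans (cong (p ++_) e) (sym (Listₚ.++-assoc p s t))) ,
         ++-≢[]ˡ p≢[]) , t≢[] , bal)))) ,
    cong toWords (sym x≡)
  -- Here the shortest prefix ends before the shortest suffix starts, so their lengths add up to at
  -- most n, against the positive excess.
  assemble (inj₂ (r , refl , refl)) = contradiction lengths (ℕₚ.<⇒≢ (begin-strict
    length q ℕ.+ length p′       ≤⟨ ℕₚ.+-monoˡ-≤ (length p′) (Listₚ.length-++-≤ʳ q {r}) ⟩
    length (r ++ q) ℕ.+ length p′ ≡⟨ ℕₚ.+-comm (length (r ++ q)) (length p′) ⟩
    length p′ ℕ.+ length (r ++ q) ≡⟨ Listₚ.length-++ p′ ⟨
    length (p′ ++ r ++ q)         ≡⟨ cong length x≡′ ⟨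
    length x                      ≡⟨ length-x ⟩
    n                             <⟨ ℕₚ.m<m+n n 0<g ⟩
    n ℕ.+ g                       ∎))
    where open ℕₚ.≤-Reasoning

-- If the prefixes x₁ x₂ and y₁ y₂ of the common walk differed, the shorter would be a balanced
-- proper prefix of the longer. Once they agree, the length g fixes the inner cut.
split-injective : ∀ {n g t t′} → Split n g t → Split n g t′ →
  toWords (join t) ≡ toWords (join t′) → t ≡ t′
split-injective {t = x₁ , x₂ , x₃} {y₁ , y₂ , y₃}
  (_ , length-x₂ , x₁≢[] , _ , bal-x , _ , min-x , _)
    (_ , length-y₂ , y₁≢[] , _ , bal-y , _ , min-y , _) e
  with x≡y ← walk-ext {join (x₁ , x₂ , x₃)} {join (y₁ , y₂ , y₃)} (cong proj₁ e)
    (Listₚ.reverse-injective (cong proj₂ e))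
  = cut (++-compare (x₁ ++ x₂) (y₁ ++ y₂) (trans (Listₚ.++-assoc x₁ x₂ x₃)
    (trans x≡y (sym (Listₚ.++-assoc y₁ y₂ y₃)))))
  where
  cut-front : x₁ ++ x₂ ≡ y₁ ++ y₂ → x₃ ≡ y₃ → (x₁ , x₂ , x₃) ≡ (y₁ , y₂ , y₃)
  cut-front e refl with refl , refl ← ++-cancel-length {p = x₁} {p′ = y₁} e
    (ℕₚ.+-cancelʳ-≡ (length x₂) _ _ (trans (sym (Listₚ.length-++ x₁)) (trans (cong length e)
      (trans (Listₚ.length-++ y₁) (cong (length y₁ ℕ.+_) (trans length-y₂ (sym length-x₂))))))) =
        refl

  cut : (∃ λ r → x₃ ≡ r ++ y₃ × y₁ ++ y₂ ≡ (x₁ ++ x₂) ++ r) ⊎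
    (∃ λ r → y₃ ≡ r ++ x₃ × x₁ ++ x₂ ≡ (y₁ ++ y₂) ++ r) →
        (x₁ , x₂ , x₃) ≡ (y₁ , y₂ , y₃)
  cut (inj₁ ([] , x₃≡ , y≡)) = cut-front (sym (trans y≡ (Listₚ.++-identityʳ _))) x₃≡
  cut (inj₂ ([] , y₃≡ , x≡)) = cut-front (trans x≡ (Listₚ.++-identityʳ _)) (sym y₃≡)
  cut (inj₁ (r@(_ ∷ _) , _ , y≡)) = contradiction bal-x (min-y (x₁ ++ x₂) r y≡ (++-≢[]ˡ x₁≢[]) λ ())
  cut (inj₂ (r@(_ ∷ _) , _ , x≡)) = contradiction bal-y (min-x (y₁ ++ y₂) r x≡ (++-≢[]ˡ y₁≢[]) λ ())

split-bijection : ∀ {n g} → 0 ℕ.< g → Bijection (Split n g) (MABWithExcess n g)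
split-bijection {n} {g} 0<g = record
  { to         = toWords ∘ join
  ; injective  = split-injective {n} {g}
  ; maps       = split⇒mab
  ; surjective = mab⇒split 0<g
  }

-- Exchanging the two words

SplitAbove SplitBelow : ℕ → ℕ → Triple → Set
SplitAbove n g t@(x₁ , _) = Split n g t × #₂ x₁ ℕ.< #₁ x₁
SplitBelow n g t@(x₁ , _) = Split n g t × #₁ x₁ ℕ.< #₂ x₁

-- On words this sends (u , v) to the pair of reversals of v and u. Unlike `mirror` it keeps the
-- direction of the walk, so each part stays in its place.
swapTriple : Triple → Triple
swapTriple (x₁ , x₂ , x₃) = map exchange x₁ , map exchange x₂ , map exchange x₃

swapTriple-involutive : ∀ t → swapTriple (swapTriple t) ≡ t
swapTriple-involutive (x₁ , x₂ , x₃) =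
  cong₂ _,_ (map-swap-involutive x₁) (cong₂ _,_ (map-swap-involutive x₂) (map-swap-involutive x₃))

split-swap : ∀ {n g t} → Split n g t → Split n g (swapTriple t)
split-swap {t = x₁ , x₂ , x₃} (length-x , length-x₂ , x₁≢[] , x₃≢[] , bal₁₂ , bal₂₃ , min₁₂ ,
  min₂₃) =
  trans (cong length (trans (cong (map exchange x₁ ++_) (sym (Listₚ.map-++ exchange x₂ x₃)))
    (sym (Listₚ.map-++ exchange x₁ (x₂ ++ x₃)))))
    (trans (Listₚ.length-map exchange (x₁ ++ x₂ ++ x₃)) length-x) ,
  trans (Listₚ.length-map exchange x₂) length-x₂ , map-≢[] exchange x₁≢[] , map-≢[] exchange x₃≢[] ,
  subst Balanced (Listₚ.map-++ exchange x₁ x₂) (balanced-swap (x₁ ++ x₂) bal₁₂) ,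
  subst Balanced (Listₚ.map-++ exchange x₂ x₃) (balanced-swap (x₂ ++ x₃) bal₂₃) ,
  (λ p q e p≢[] q≢[] bal → min₁₂ (map exchange p) (map exchange q) (unswap x₁ x₂ p q e)
    (map-≢[] exchange p≢[]) (map-≢[] exchange q≢[]) (balanced-swap p bal)) ,
  (λ p q e p≢[] q≢[] bal → min₂₃ (map exchange p) (map exchange q) (unswap x₂ x₃ p q e)
    (map-≢[] exchange p≢[]) (map-≢[] exchange q≢[]) (balanced-swap q bal))
  where
  unswap : ∀ x y p q → map exchange x ++ map exchange y ≡ p ++ q →
    x ++ y ≡ map exchange p ++ map exchange q
  unswap x y p q e = begin
    x ++ y                               ≡⟨ map-swap-involutive (x ++ y) ⟨
    map exchange (map exchange (x ++ y))         ≡⟨ cong (map exchange)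
      (trans (Listₚ.map-++ exchange x y) e) ⟩
    map exchange (p ++ q)                    ≡⟨ Listₚ.map-++ exchange p q ⟩
    map exchange p ++ map exchange q             ∎
    where open ≡-Reasoning

swap-bijection : ∀ {n g} → Bijection (SplitBelow n g) (SplitAbove n g)
swap-bijection = record
  { to         = swapTriple
  ; injective  = λ {t} {t′} _ _ e → trans (sym (swapTriple-involutive t))
    (trans (cong swapTriple e) (swapTriple-involutive t′))
  ; maps       = λ {t} (s , <) → split-swap s ,
    subst₂ ℕ._<_ (sym (#₂-swap (proj₁ t))) (sym (#₁-swap (proj₁ t))) <
  ; surjective = λ {t} (s , <) → swapTriple t ,
      (split-swap s , subst₂ ℕ._<_ (sym (#₁-swap (proj₁ t))) (sym (#₂-swap (proj₁ t))) <) ,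
        swapTriple-involutive t
  }

module _ {n g} (0<g : 0 ℕ.< g) (E : Enumeration (SplitAbove n g)) where

  private
    above : Triple → Bool
    above (x₁ , _) = does (#₂ x₁ ℕ.<? #₁ x₁)

    Half : Bool → Triple → Set
    Half true  = SplitAbove n g
    Half false = SplitBelow n g

    half⇒above : ∀ {c t} → Half c t → above t ≡ c
    half⇒above {true}  {x₁ , _} (_ , <) = dec-true (#₂ x₁ ℕ.<? #₁ x₁) <
    half⇒above {false} {x₁ , _} (_ , <) = dec-false (#₂ x₁ ℕ.<? #₁ x₁) (ℕₚ.<⇒≯ <)

    halfᴱ : ∀ c → Enumeration (Half c)
    halfᴱ true  = E
    halfᴱ false = pullbackᴱ swap-bijection E

    signs : List Bool
    signs = true ∷ false ∷ []

    signs-unique : Unique signs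
    signs-unique = ((λ ()) ∷ []) ∷ [] ∷ []

    half⇒fibres : ∀ {t} c → Half c t → Fibres Half above signs t
    half⇒fibres {t} c h with refl ← half⇒above {c} {t} h = ∈-signs (above t) , h
      where
      ∈-signs : ∀ c → c ∈ signs
      ∈-signs true  = here refl
      ∈-signs false = there (here refl)

    split⇒fibres : ∀ {t} → Split n g t → Fibres Half above signs t
    split⇒fibres {x₁ , x₂ , x₃} s@(_ , length-x₂ , x₁≢[] , _ , _ , _ , min₁₂ , _) =
      half⇒fibres′ (ℕₚ.<-cmp (#₂ x₁) (#₁ x₁))
      where
      half⇒fibres′ : Tri (#₂ x₁ ℕ.< #₁ x₁) (#₂ x₁ ≡ #₁ x₁) (#₁ x₁ ℕ.< #₂ x₁) →
        Fibres Half above signs (x₁ , x₂ , x₃)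
      half⇒fibres′ (tri< < _ _) = half⇒fibres true (s , <)
      -- A tie would make x₁ a balanced prefix of x₁ x₂, and a proper one because g > 0.
      half⇒fibres′ (tri≈ _ e _) = contradiction (sym e)
        (min₁₂ x₁ x₂ refl x₁≢[] λ { refl → ℕₚ.<⇒≢ 0<g length-x₂ })
      half⇒fibres′ (tri> _ _ >) = half⇒fibres false (s , >)

    fibres⇒split : ∀ {t} → Fibres Half above signs t → Split n g t
    fibres⇒split {t} (_ , h) = half⇒split (above t) h
      where
      half⇒split : ∀ c → Half c t → Split n g t
      half⇒split true  = proj₁
      half⇒split false = proj₁

  𝓜ᵒ≡2*above : 𝓜ᵒ g n ≡ 2 ℕ.* size E
  𝓜ᵒ≡2*above = begin
    𝓜ᵒ g n
      ≡⟨ size-pullbackᴱ (split-bijection 0<g) (mabWithExcess-enumeration n g) ⟨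
    size (pullbackᴱ (split-bijection 0<g) (mabWithExcess-enumeration n g))
      ≡⟨ size-unique (pullbackᴱ (split-bijection 0<g) (mabWithExcess-enumeration n g))
           (respᴱ (fibres⇒split , split⇒fibres) (⋃ᴱ (λ {c} → half⇒above {c}) signs-unique halfᴱ)) ⟩
    size (⋃ᴱ (λ {c} → half⇒above {c}) signs-unique halfᴱ)
      ≡⟨ size-⋃ᴱ (λ {c} → half⇒above {c}) signs-unique halfᴱ ⟩
    size E ℕ.+ (size (pullbackᴱ swap-bijection E) ℕ.+ 0)
      ≡⟨ cong (λ s → size E ℕ.+ (s ℕ.+ 0)) (size-pullbackᴱ swap-bijection E) ⟩
    2 ℕ.* size E ∎
    where open ≡-Reasoning

-- Counting by (i , l₂ , l₁ , k , m)

#₁≤length : ∀ x → #₁ x ℕ.≤ length x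
#₁≤length x = subst (#₁ x ℕ.≤_) (trans (sym (length-letters (map proj₁ x)))
  (Listₚ.length-map proj₁ x)) (ℕₚ.m≤m+n _ _)

#₂≤length : ∀ x → #₂ x ℕ.≤ length x
#₂≤length x = subst (#₂ x ℕ.≤_) (trans (sym (length-letters (map proj₂ x)))
  (Listₚ.length-map proj₂ x)) (ℕₚ.m≤m+n _ _)

module _ {X : Set} {Q : ℤ → X → Set} {key : X → ℤ} (Q⇒key : ∀ z x → Q z x → key x ≡ z) (lo hi : ℤ)
  (E : ∀ z → Enumeration (Q z)) where

  rangeᴱ : Enumeration (Fibres Q key ⟦ lo ⋯ hi ⟧)
  rangeᴱ = ⋃ᴱ (λ {z} {x} → Q⇒key z x) (⟦⟧-unique lo hi) E

  fromℕ-size-rangeᴱ : ∀ (f : ℤ → ℚ) → (∀ z → z ∈ ⟦ lo ⋯ hi ⟧ → fromℕ (size (E z)) ≡ f z) →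
    fromℕ (size rangeᴱ) ≡ ∑ lo hi f
  fromℕ-size-rangeᴱ f e = trans (cong fromℕ (size-⋃ᴱ (λ {z} {x} → Q⇒key z x) (⟦⟧-unique lo hi) E))
    (fromℕ-sum ⟦ lo ⋯ hi ⟧ (λ z → size (E z)) f (λ {z} → e z))

-- The difference of the counts changes by at most 1 per step, so it cannot change sign without
-- vanishing.
ascend : ∀ p q → #₂ p ℕ.< #₁ p → (∀ r s → q ≡ r ++ s → r ≢ [] → ¬ Balanced (p ++ r)) →
         #₂ (p ++ q) ℕ.< #₁ (p ++ q)
ascend p []      < nb = subst (λ x → #₂ x ℕ.< #₁ x) (sym (Listₚ.++-identityʳ p)) <
ascend p (s ∷ q) < nb = subst (λ x → #₂ x ℕ.< #₁ x) (Listₚ.++-assoc p [ s ] q)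
  (ascend (p ++ [ s ]) q (ℕₚ.≤∧≢⇒< below (λ e → nb [ s ] q refl (λ ()) (sym e)))
    λ r t e r≢[] bal → nb (s ∷ r) t (cong (s ∷_) e) (λ ())
      (subst Balanced (Listₚ.++-assoc p [ s ] r) bal))
  where
  open ℕₚ.≤-Reasoning
  below : #₂ (p ++ [ s ]) ℕ.≤ #₁ (p ++ [ s ])
  below = begin
    #₂ (p ++ [ s ])        ≡⟨ #₂-++ p [ s ] ⟩
    #₂ p ℕ.+ #₂ [ s ]      ≤⟨ ℕₚ.+-monoʳ-≤ (#₂ p) (#₂≤length [ s ]) ⟩
    #₂ p ℕ.+ 1             ≡⟨ ℕₚ.+-comm (#₂ p) 1 ⟩
    suc (#₂ p)             ≤⟨ < ⟩
    #₁ p                   ≤⟨ ℕₚ.m≤m+n (#₁ p) (#₁ [ s ]) ⟩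
    #₁ p ℕ.+ #₁ [ s ]      ≡⟨ #₁-++ p [ s ] ⟨
    #₁ (p ++ [ s ])        ∎

-- The first step decides. Equal letters form a balanced prefix. The step `(b , a)` closes a gap of
-- 1 at once, too early as g ≥ 2. After `(a , b)` the first word stays ahead by `ascend`, so the gap
-- grows and the paths cannot end together.
mid-gap : ∀ {g l₁ l₂ k x} → 2 ℕ.≤ g → Mid g (+ l₁) (+ l₂) k x → l₁ ≢ suc l₂
mid-gap {x = (a , a) ∷ t ∷ y} _ (_ , _ , _ , _ , nbp) _ = nbp [ a , a ] (t ∷ y) refl (λ ()) refl
mid-gap {x = (b , b) ∷ t ∷ y} _ (_ , _ , _ , _ , nbp) _ = nbp [ b , b ] (t ∷ y) refl (λ ()) refl
mid-gap {l₂ = l₂} {x = (b , a) ∷ t ∷ y} _ (_ , _ , _ , apart , _) refl =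
  apart [ b , a ] (t ∷ y) refl (λ ()) (cong +_ (trans (ℕₚ.+-identityʳ (suc l₂)) (ℕₚ.+-comm 1 l₂)))
mid-gap {l₂ = l₂} {x = (a , b) ∷ t ∷ y} _ (_ , k≡₁ , k≡₂ , _ , nbp) refl =
  ℕₚ.<⇒≢ (ℕₚ.+-mono-<-≤ (ℕₚ.n<1+n l₂) (ℕₚ.<⇒≤ (ascend [ a , b ] (t ∷ y) (s≤s z≤n)
      λ r s e _ → nbp ((a , b) ∷ r) s (cong (_ ∷_) e) λ ())))
    (ℤₚ.+-injective (trans k≡₂ (sym k≡₁)))
mid-gap {x = []}     (s≤s _)       (() , _)
mid-gap {x = _ ∷ []} (s≤s (s≤s _)) (() , _)

module _ (n g : ℕ) where

  j-of : ℤ → ℤ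
  j-of i = + n + + g - i

  k′-of : ℤ → ℤ → ℤ → ℤ
  k′-of k l₁ l₂ = k + l₁ - l₂

  -- On a split, i = |x₂ x₃| = lsb(u,v), k counts the a's of the first word in x₁ x₂, and m those in
  -- all of u.
  i-key l₂-key l₁-key k-key m-key : Triple → ℤ
  i-key  (x₁ , _)           = + n - + length x₁
  l₂-key (x₁ , _)           = + #₂ x₁
  l₁-key (x₁ , _)           = + #₁ x₁
  k-key  (x₁ , x₂ , _)      = + #₁ x₁ + + #₁ x₂
  m-key  t@(_ , _ , x₃)     = k-key t + + #₁ x₃

  -- With the counts fixed, balance of both overlapping factors says that x₃ has m - k and m - k′
  -- letters `a` in its two words, so a fibre is a plain product.
  Fibre : ℤ → ℤ → ℤ → ℤ → ℤ → Triple → Set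
  Fibre i l₂ l₁ k m =
    (λ x₁ → Sep (+ n - i) l₁ l₂ (reverse x₁)) ⟨×⟩
    Mid g l₁ l₂ k ⟨×⟩
    Sep (+ n - j-of i) (m - k) (m - k′-of k l₁ l₂)

  fibre⇒keys : ∀ i l₂ l₁ k m t → Fibre i l₂ l₁ k m t →
    i-key t ≡ i × l₂-key t ≡ l₂ × l₁-key t ≡ l₁ × k-key t ≡ k × m-key t ≡ m
  fibre⇒keys i l₂ l₁ k m (x₁ , x₂ , x₃) ((e-i , e-l₁ , e-l₂ , _) , (_ , e-k , _) , (_ , e-m , _)) =
    trans (cong (+ n -_) (trans (cong +_ (sym (Listₚ.length-reverse x₁))) e-i)) (sub-sub (+ n) i) ,
    trans (cong +_ (sym (#₂-reverse x₁))) e-l₂ , l₁≡ , k≡ , trans (cong₂ _+_ k≡ e-m) (add-sub k m)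
    where
    l₁≡ = trans (cong +_ (sym (#₁-reverse x₁))) e-l₁
    k≡ = trans (cong (_+ + #₁ x₂) l₁≡) e-k
    sub-sub : ∀ x y → x - (x - y) ≡ y
    sub-sub = solve-∀
    add-sub : ∀ x y → x + (y - x) ≡ y
    add-sub = solve-∀

  -- This and the next four definitions give one layer per sum, with the bounds of the theorem.
  Fibre₄ : ℤ → ℤ → ℤ → ℤ → Triple → Set
  Fibre₄ i l₂ l₁ k = Fibres (Fibre i l₂ l₁ k) m-key ⟦ k′-of k l₁ l₂ ⋯ + n - j-of i + k ⟧

  Fibre₃ : ℤ → ℤ → ℤ → Triple → Set
  Fibre₃ i l₂ l₁ = Fibres (Fibre₄ i l₂ l₁) k-key ⟦ l₁ ⋯ + g + l₂ ⟧

  Fibre₂ : ℤ → ℤ → Triple → Set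
  Fibre₂ i l₂ = Fibres (Fibre₃ i l₂) l₁-key ⟦ l₂ + + 2 ⋯ + n - i ⟧

  Fibre₁ : ℤ → Triple → Set
  Fibre₁ i = Fibres (Fibre₂ i) l₂-key ⟦ + 0 ⋯ + n - i - + 2 ⟧

  Fibre₀ : Triple → Set
  Fibre₀ = Fibres Fibre₁ i-key ⟦ + g + + 1 ⋯ + n - + 1 ⟧

  reverse-bijection : ∀ {P : Walk → Set} → Bijection (P ∘ reverse) P
  reverse-bijection {P} = record
    { to         = reverse
    ; injective  = λ _ _ → Listₚ.reverse-injective
    ; maps       = λ p → p
    ; surjective = λ {y} py → reverse y , subst P (sym (Listₚ.reverse-involutive y)) py ,
      Listₚ.reverse-involutive y
    }

  j≡ : ∀ i → j-of i ≡ + n - i + + g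
  j≡ i = rearrange (+ n) (+ g) i
    where
    rearrange : ∀ x y z → x + y - z ≡ x - z + y
    rearrange = solve-∀

  fibreᴱ : ∀ i l₂ l₁ k m → Enumeration (Fibre i l₂ l₁ k m)
  fibreᴱ i l₂ l₁ k m =
    pullbackᴱ reverse-bijection (sepᴱ (+ n - i) l₁ l₂) ×ᴱ
    midᴱ (+ n - i) (j-of i) l₁ l₂ k g (j≡ i) ×ᴱ
    sepᴱ (+ n - j-of i) (m - k) (m - k′-of k l₁ l₂)

  m-fibre : ∀ i l₂ l₁ k m t → Fibre i l₂ l₁ k m t → m-key t ≡ m
  m-fibre i l₂ l₁ k m t f = let _ , _ , _ , _ , e = fibre⇒keys i l₂ l₁ k m t f in e

  k-fibre : ∀ i l₂ l₁ k t → Fibre₄ i l₂ l₁ k t → k-key t ≡ k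
  k-fibre i l₂ l₁ k t (_ , f) = let _ , _ , _ , e , _ = fibre⇒keys i l₂ l₁ k (m-key t) t f in e

  l₁-fibre : ∀ i l₂ l₁ t → Fibre₃ i l₂ l₁ t → l₁-key t ≡ l₁
  l₁-fibre i l₂ l₁ t (_ , _ , f) =
    let _ , _ , e , _ = fibre⇒keys i l₂ l₁ (k-key t) (m-key t) t f in e

  l₂-fibre : ∀ i l₂ t → Fibre₂ i l₂ t → l₂-key t ≡ l₂
  l₂-fibre i l₂ t (_ , _ , _ , f) =
    let _ , e , _ = fibre⇒keys i l₂ (l₁-key t) (k-key t) (m-key t) t f in e

  i-fibre : ∀ i t → Fibre₁ i t → i-key t ≡ i
  i-fibre i t (_ , _ , _ , _ , f) =
    let e , _ = fibre⇒keys i (l₂-key t) (l₁-key t) (k-key t) (m-key t) t f in e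

  fibre₄ᴱ : ∀ i l₂ l₁ k → Enumeration (Fibre₄ i l₂ l₁ k)
  fibre₄ᴱ i l₂ l₁ k = rangeᴱ (m-fibre i l₂ l₁ k) (k + l₁ - l₂) (+ n - (+ n + + g - i) + k)
    (fibreᴱ i l₂ l₁ k)

  fibre₃ᴱ : ∀ i l₂ l₁ → Enumeration (Fibre₃ i l₂ l₁)
  fibre₃ᴱ i l₂ l₁ = rangeᴱ (k-fibre i l₂ l₁) l₁ (+ g + l₂) (fibre₄ᴱ i l₂ l₁)

  fibre₂ᴱ : ∀ i l₂ → Enumeration (Fibre₂ i l₂)
  fibre₂ᴱ i l₂ = rangeᴱ (l₁-fibre i l₂) (l₂ + + 2) (+ n - i) (fibre₃ᴱ i l₂)

  fibre₁ᴱ : ∀ i → Enumeration (Fibre₁ i)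
  fibre₁ᴱ i = rangeᴱ (l₂-fibre i) (+ 0) (+ n - i - + 2) (fibre₂ᴱ i)

  fibre₀ᴱ : Enumeration Fibre₀
  fibre₀ᴱ = rangeᴱ i-fibre (+ g + + 1) (+ n - + 1) fibre₁ᴱ

-- Splits and fibres coincide

-- Linear arithmetic by certificate: `p ≡ q` is a sum of known equations, and the second argument is
-- a pure ring identity.
by-difference : ∀ {x y p q} → p ≡ q → x - y ≡ p - q → x ≡ y
by-difference {x} {y} {p} refl e = ℤₚ.i-j≡0⇒i≡j x y (trans e (ℤₚ.+-inverseʳ p))

suc-of : ∀ {x : Walk} → x ≢ [] → ∃ λ r → length x ≡ suc r
suc-of {[]}    x≢[] = contradiction refl x≢[]
suc-of {_ ∷ x} _    = length x , refl

length-positive : ∀ {x : Walk} {r} → length x ≡ suc r → x ≢ []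
length-positive {[]} () refl

module _ (n g : ℕ) where

  middle : ∀ {x₁ x₂ x₃} → Split n g (x₁ , x₂ , x₃) →
           Mid g (+ #₁ x₁) (+ #₂ x₁) (k-key n g (x₁ , x₂ , x₃)) x₂
  middle {x₁} {x₂} {x₃} (_ , length-x₂ , x₁≢[] , x₃≢[] , bal₁₂ , bal₂₃ , min₁₂ , min₂₃) =
    length-x₂ , refl ,
    cong +_ (trans (sym (#₂-++ x₁ x₂)) (trans (sym bal₁₂) (#₁-++ x₁ x₂))) ,
    (λ p q x₂≡ q≢[] e → min₁₂ (x₁ ++ p) q (trans (cong (x₁ ++_) x₂≡) (sym (Listₚ.++-assoc x₁ p q)))
      (++-≢[]ˡ x₁≢[]) q≢[] (trans (#₁-++ x₁ p) (trans (ℤₚ.+-injective e) (sym (#₂-++ x₁ p))))) ,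
    -- Removing a balanced prefix of x₂ from x₂ x₃ would leave a shorter balanced suffix.
    λ p q x₂≡ p≢[] e → min₂₃ p (q ++ x₃) (trans (cong (_++ x₃) x₂≡) (Listₚ.++-assoc p q x₃)) p≢[]
      (++-≢[]ʳ q x₃≢[])
      (remainder p (q ++ x₃) (subst Balanced (trans (cong (_++ x₃) x₂≡) (Listₚ.++-assoc p q x₃))
        bal₂₃) e)
    where
    remainder : ∀ p q → Balanced (p ++ q) → Balanced p → Balanced q
    remainder p q bal e = ℕₚ.+-cancelˡ-≡ (#₁ p) _ _
      (trans (sym (#₁-++ p q)) (trans bal (trans (#₂-++ p q) (cong (ℕ._+ #₂ q) (sym e)))))

  above⇒fibre₀ : 2 ≤ g → ∀ {t} → SplitAbove n g t → Fibre₀ n g t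
  above⇒fibre₀ 2≤g {t@(x₁ , x₂ , x₃)} (split@(length-x , length-x₂ , x₁≢[] , x₃≢[] , bal₁₂ ,
    bal₂₃ , min₁₂ , min₂₃) , l₂<l₁)
    -- The slacks in the summation bounds: `u₁` and `u₃` count the b's of the first word in x₁ and
    -- x₃, `u₂` those of the second word in x₂, `d` is l₁ - l₂ - 2, and `s₁`, `s₃` come from x₁ and
    -- x₃ being nonempty.
    with s₁ , X₁≡ ← suc-of x₁≢[] | s₃ , X₃≡ ← suc-of x₃≢[]
    with u₁ , l₁+u₁≡ ← ℕₚ.m≤n⇒∃[o]m+o≡n (#₁≤length x₁)
       | u₂ , #x₂+u₂≡ ← ℕₚ.m≤n⇒∃[o]m+o≡n (#₂≤length x₂)
       | u₃ , #x₃+u₃≡ ← ℕₚ.m≤n⇒∃[o]m+o≡n (#₁≤length x₃)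
       | d , 2+l₂+d≡ ← ℕₚ.m≤n⇒∃[o]m+o≡n (ℕₚ.≤∧≢⇒< l₂<l₁ (mid-gap 2≤g (middle split) ∘ sym))
    = ∈-⟦⟧⁺ (+ g + + 1) (+ n - + 1) s₃ s₁
        (by-difference N′ (trans (cong (λ X₃ → + n - + X₁ - (+ g + + 1 + X₃)) (sym (pred-of X₃≡)))
          (r₁ (+ n) (+ X₁) (+ g) (+ X₃))))
        (trans (r₂ (+ n) (+ s₁)) (cong (λ X₁ → + n - + X₁ + + s₁) (sym X₁≡))) ,
      ∈-⟦⟧⁺ (+ 0) (+ n - i - + 2) l₂ (d ℕ.+ u₁) refl
        (by-difference (cong₂ (λ x y → + x + + y) (sym l₁+u₁≡) (sym 2+l₂+d≡))
          (r₃ (+ n) (+ X₁) (+ l₂) (+ d) (+ u₁) (+ l₁))) ,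
      ∈-⟦⟧⁺ (+ l₂ + + 2) (+ n - i) d u₁
        (by-difference (cong +_ (sym 2+l₂+d≡)) (r₄ (+ l₁) (+ l₂) (+ d)))
        (by-difference (cong +_ (sym l₁+u₁≡)) (r₅ (+ n) (+ X₁) (+ l₁) (+ u₁))) ,
      ∈-⟦⟧⁺ (+ l₁) (+ g + + l₂) (#₁ x₂) u₂ refl
        (by-difference (cong₂ (λ x y → + x + + y) (sym (trans #x₂+u₂≡ length-x₂)) (sym e₁₂))
          (r₆ (+ g) (+ l₂) (+ l₁) (+ #₁ x₂) (+ #₂ x₂) (+ u₂))) ,
      ∈-⟦⟧⁺ (k + + l₁ - + l₂) (+ n - (+ n + + g - i) + k) (#₂ x₃) u₃
        (by-difference (cong₂ (λ x y → + x + + y) (sym e₁₂) e₂₃)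
          (r₇ (+ l₁) (+ l₂) (+ #₁ x₂) (+ #₂ x₂) (+ #₁ x₃) (+ #₂ x₃)))
        (by-difference (cong₂ _+_ N′ (cong +_ (sym #x₃+u₃≡)))
          (r₈ (+ n) (+ g) (+ X₁) (+ X₃) (+ (l₁ ℕ.+ #₁ x₂)) (+ #₁ x₃) (+ u₃))) ,
      (trans (cong +_ (Listₚ.length-reverse x₁)) (r₉ (+ n) (+ X₁)) , cong +_ (#₁-reverse x₁) ,
        cong +_ (#₂-reverse x₁) , nbs₁) ,
      middle split ,
      (by-difference (sym N′) (r₁₀ (+ n) (+ g) (+ X₁) (+ X₃)) ,
       r₁₁ (+ (l₁ ℕ.+ #₁ x₂)) (+ #₁ x₃) ,
       by-difference (cong₂ (λ x y → + x + + y) e₁₂ (sym e₂₃))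
          (r₁₂ (+ l₁) (+ l₂) (+ #₁ x₂) (+ #₂ x₂) (+ #₁ x₃) (+ #₂ x₃)) ,
       nbs₃)
    where
    X₁ = length x₁
    X₃ = length x₃
    l₁ = #₁ x₁
    l₂ = #₂ x₁
    i = + n - + X₁
    k = + l₁ + + #₁ x₂

    pred-of : ∀ {m r} → m ≡ suc r → + m - + 1 ≡ + r
    pred-of refl = refl

    N′ : + n ≡ + X₁ + (+ g + + X₃)
    N′ = cong +_ (trans (sym length-x) (trans (Listₚ.length-++ x₁)
      (cong (X₁ ℕ.+_) (trans (Listₚ.length-++ x₂) (cong (ℕ._+ X₃) length-x₂)))))

    e₁₂ : l₁ ℕ.+ #₁ x₂ ≡ l₂ ℕ.+ #₂ x₂
    e₁₂ = trans (sym (#₁-++ x₁ x₂)) (trans bal₁₂ (#₂-++ x₁ x₂))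

    e₂₃ : #₁ x₂ ℕ.+ #₁ x₃ ≡ #₂ x₂ ℕ.+ #₂ x₃
    e₂₃ = trans (sym (#₁-++ x₂ x₃)) (trans bal₂₃ (#₂-++ x₂ x₃))

    x₂≢[] : x₂ ≢ []
    x₂≢[] refl with () ← ℕₚ.≤-trans 2≤g (ℕₚ.≤-reflexive (sym length-x₂))

    nbs₁ : NoBalancedSuffix (reverse x₁)
    nbs₁ p q e q≢[] bal = min₁₂ (reverse q) (reverse p ++ x₂)
      (trans (cong (_++ x₂) (trans (sym (Listₚ.reverse-involutive x₁))
        (trans (cong reverse e) (Listₚ.reverse-++ p q))))
        (Listₚ.++-assoc (reverse q) (reverse p) x₂))
      (reverse-≢[] q≢[]) (++-≢[]ʳ (reverse p) x₂≢[]) (balanced-reverse q bal)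

    nbs₃ : NoBalancedSuffix x₃
    nbs₃ p q e q≢[] bal = min₂₃ (x₂ ++ p) q (trans (cong (x₂ ++_) e) (sym (Listₚ.++-assoc x₂ p q)))
      (++-≢[]ˡ x₂≢[]) q≢[] bal

    r₁ : ∀ n x g y → n - x - (g + + 1 + (y - + 1)) ≡ n - (x + (g + y))
    r₁ = solve-∀
    r₂ : ∀ n s → n - + 1 ≡ n - (+ 1 + s) + s
    r₂ = solve-∀
    r₃ : ∀ n x l₂ d u l₁ → n - (n - x) - + 2 - (l₂ + (d + u)) ≡ x + l₁ - (l₁ + u + (+ 2 + l₂ + d))
    r₃ = solve-∀
    r₄ : ∀ l₁ l₂ d → l₁ - (l₂ + + 2 + d) ≡ l₁ - (+ 2 + l₂ + d)
    r₄ = solve-∀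
    r₅ : ∀ n x l u → n - (n - x) - (l + u) ≡ x - (l + u)
    r₅ = solve-∀
    r₆ : ∀ g l₂ l₁ y₁ y₂ u → g + l₂ - (l₁ + y₁ + u) ≡ g + (l₂ + y₂) - (y₂ + u + (l₁ + y₁))
    r₆ = solve-∀
    r₇ : ∀ l₁ l₂ y₁ y₂ z₁ z₂ → l₁ + y₁ + z₁ - (l₁ + y₁ + l₁ - l₂ + z₂) ≡ l₂ + y₂ + (y₁ + z₁)
      - (l₁ + y₁ + (y₂ + z₂))
    r₇ = solve-∀
    r₈ : ∀ n g x z k z₁ u → n - (n + g - (n - x)) + k - (k + z₁ + u) ≡ n + z
      - (x + (g + z) + (z₁ + u))
    r₈ = solve-∀
    r₉ : ∀ n x → x ≡ n - (n - x)
    r₉ = solve-∀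
    r₁₀ : ∀ n g x z → z - (n - (n + g - (n - x))) ≡ x + (g + z) - n
    r₁₀ = solve-∀
    r₁₁ : ∀ k z → z ≡ k + z - k
    r₁₁ = solve-∀
    r₁₂ : ∀ l₁ l₂ y₁ y₂ z₁ z₂ → z₂ - (l₁ + y₁ + z₁ - (l₁ + y₁ + l₁ - l₂)) ≡ l₁ + y₁ + (y₂ + z₂)
      - (l₂ + y₂ + (y₁ + z₁))
    r₁₂ = solve-∀

  fibre₀⇒above : ∀ {t} → Fibre₀ n g t → SplitAbove n g t
  fibre₀⇒above {x₁ , x₂ , x₃} (i∈ , _ , l₁∈ , _ , _ , (_ , _ , _ , nbs₁) ,
    (length-x₂ , _ , k≡ , apart , nbp) , (e₃ , _ , m-k′≡ , nbs₃))
    -- Since |x₃| = i - g, the bound i ≥ g + 1 makes x₃ nonempty, with `r` one less than its length;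
    -- the bound on l₁ gives l₂ < l₁ and hence a nonempty x₁.
    with (r , i≡) , _ ← ∈-⟦⟧⁻ (+ g + + 1) (+ n - + 1) i∈ | (d , l₁≡) ,
      _ ← ∈-⟦⟧⁻ (+ #₂ x₁ + + 2) (+ n - i-key n g (x₁ , x₂ , x₃)) l₁∈ =
    (length-x , length-x₂ , x₁≢[] , length-positive (ℤₚ.+-injective X₃≡) , bal₁₂ , bal₂₃ , min₁₂ ,
      min₂₃) , l₂<l₁
    where
    X₁ = length x₁
    X₃ = length x₃
    l₁ = #₁ x₁
    l₂ = #₂ x₁

    q₁ : ∀ n g x z → n - (x + (g + z)) ≡ n - (n + g - (n - x)) - z
    q₁ = solve-∀
    q₂ : ∀ n g x r → n - (n + g - (n - x)) - (+ 1 + r) ≡ n - x - (g + + 1 + r)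
    q₂ = solve-∀
    q₃ : ∀ l₁ l₂ y₁ y₂ z₁ z₂ → y₁ + z₁ - (y₂ + z₂) ≡ l₁ + y₁ + (l₁ + y₁ + z₁ - (l₁ + y₁ + l₁ - l₂))
      - (l₂ + y₂ + z₂)
    q₃ = solve-∀

    length-x : length (x₁ ++ x₂ ++ x₃) ≡ n
    length-x = trans (Listₚ.length-++ x₁) (trans
      (cong (X₁ ℕ.+_) (trans (Listₚ.length-++ x₂) (cong (ℕ._+ X₃) length-x₂)))
      (sym (ℤₚ.+-injective (by-difference (sym e₃) (q₁ (+ n) (+ g) (+ X₁) (+ X₃))))))

    X₃≡ : + X₃ ≡ + suc r
    X₃≡ = trans e₃ (by-difference i≡ (q₂ (+ n) (+ g) (+ X₁) (+ r)))

    l₂<l₁ : l₂ ℕ.< l₁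
    l₂<l₁ = subst (l₂ ℕ.<_) (sym (trans (ℤₚ.+-injective l₁≡)
      (trans (ℕₚ.+-assoc l₂ 2 d) (ℕₚ.+-suc l₂ (suc d))))) (s≤s (ℕₚ.m≤m+n l₂ (suc d)))

    x₁≢[] : x₁ ≢ []
    x₁≢[] refl with () ← l₂<l₁

    e₁₂ : l₁ ℕ.+ #₁ x₂ ≡ l₂ ℕ.+ #₂ x₂
    e₁₂ = sym (ℤₚ.+-injective k≡)

    bal₁₂ : Balanced (x₁ ++ x₂)
    bal₁₂ = trans (#₁-++ x₁ x₂) (trans e₁₂ (sym (#₂-++ x₁ x₂)))

    bal₂₃ : Balanced (x₂ ++ x₃)
    bal₂₃ = trans (#₁-++ x₂ x₃) (trans (ℤₚ.+-injective
      (by-difference (cong₂ _+_ (cong +_ e₁₂) (sym m-k′≡))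
      (q₃ (+ l₁) (+ l₂) (+ #₁ x₂) (+ #₂ x₂) (+ #₁ x₃) (+ #₂ x₃)))) (sym (#₂-++ x₂ x₃)))

    min₁₂ : ∀ p q → x₁ ++ x₂ ≡ p ++ q → p ≢ [] → q ≢ [] → ¬ Balanced p
    min₁₂ p q e p≢[] q≢[] bal with ++-compare x₁ p e
    ... | inj₁ (r , x₂≡ , refl) = apart r q x₂≡ q≢[]
      (cong +_ (trans (sym (#₁-++ x₁ r)) (trans bal (#₂-++ x₁ r))))
    ... | inj₂ (r , _ , x₁≡) = nbs₁ (reverse r) (reverse p)
      (trans (cong reverse x₁≡) (Listₚ.reverse-++ p r))
      (reverse-≢[] p≢[]) (balanced-reverse p bal)

    min₂₃ : ∀ p q → x₂ ++ x₃ ≡ p ++ q → p ≢ [] → q ≢ [] → ¬ Balanced q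
    min₂₃ p q e p≢[] q≢[] bal with ++-compare x₂ p e
    ... | inj₁ (r , x₃≡ , _) = nbs₃ r q x₃≡ q≢[] bal
    -- The complement argument in the other direction: if `q` starts inside x₂ and is balanced, so
    -- is the prefix `p` of x₂ before it.
    ... | inj₂ (r , _ , x₂≡) = nbp p r x₂≡ p≢[] (ℕₚ.+-cancelʳ-≡ (#₁ q) _ _ (trans (sym (#₁-++ p q))
      (trans (subst Balanced e bal₂₃) (trans (#₂-++ p q) (cong (#₂ p ℕ.+_) (sym bal))))))

  -- The summand and the final sum

  size-fibre : ∀ i l₂ l₁ k m → l₂ ℤ.< l₁ →
    let j = + n + + g - i ; k′ = k + l₁ - l₂ in
    fromℕ (size (fibreᴱ n g i l₂ l₁ k m)) ≡
      (l₁ - l₂) // (+ n - i)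
        * fromℕ (binom (+ n - i) l₁)
        * fromℕ (binom (+ n - i) l₂)
        * fromℕ (∣𝒩∣ (l₂ , + n - i - l₂) (l₁ , + n - i - l₁) (k , j - k))
        * ((l₁ - l₂) // (+ n - j))
        * fromℕ (binom (+ n - j) (m - k))
        * fromℕ (binom (+ n - j) (m - k′))
  size-fibre i l₂ l₁ k m l₂<l₁ = begin
    fromℕ (size (front ×ᴱ mid ×ᴱ rear))
      ≡⟨ cong fromℕ (trans (size-×ᴱ front (mid ×ᴱ rear))
        (cong (size front ℕ.*_) (size-×ᴱ mid rear))) ⟩
    fromℕ (size front ℕ.* (size mid ℕ.* size rear))
      ≡⟨ trans (fromℕ-* (size front) _) (cong (fromℕ (size front) *_)
        (fromℕ-* (size mid) (size rear))) ⟩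
    fromℕ (size front) * (fromℕ (size mid) * fromℕ (size rear))
      ≡⟨ cong₂ _*_ (trans (cong fromℕ (size-pullbackᴱ (reverse-bijection n g)
        (sepᴱ (+ n - i) l₁ l₂))) (fromℕ-size-sep (+ n - i) l₂<l₁))
           (cong₂ _*_ (cong fromℕ (size-midᴱ (+ n - i) j l₁ l₂ k g (j≡ n g i)))
             (trans (fromℕ-size-sep (+ n - j) m-k′<m-k)
               (cong (λ δ → δ // (+ n - j) * B₃ * B₄) (gap m k l₁ l₂)))) ⟩
    F * (M * (D * B₃ * B₄))
      ≡⟨ ℚₚ.*-assoc F M (D * B₃ * B₄) ⟨
    F * M * (D * B₃ * B₄)
      ≡⟨ ℚₚ.*-assoc (F * M) (D * B₃) B₄ ⟨
    F * M * (D * B₃) * B₄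
      ≡⟨ cong (_* B₄) (ℚₚ.*-assoc (F * M) D B₃) ⟨
    F * M * D * B₃ * B₄ ∎
    where
    open ≡-Reasoning
    j = + n + + g - i
    k′ = k + l₁ - l₂
    front = pullbackᴱ (reverse-bijection n g) (sepᴱ (+ n - i) l₁ l₂)
    mid = midᴱ (+ n - i) j l₁ l₂ k g (j≡ n g i)
    rear = sepᴱ (+ n - j) (m - k) (m - k′)
    F = (l₁ - l₂) // (+ n - i) * fromℕ (binom (+ n - i) l₁) * fromℕ (binom (+ n - i) l₂)
    M = fromℕ (∣𝒩∣ (l₂ , + n - i - l₂) (l₁ , + n - i - l₁) (k , j - k))
    D = (l₁ - l₂) // (+ n - j)
    B₃ = fromℕ (binom (+ n - j) (m - k))
    B₄ = fromℕ (binom (+ n - j) (m - k′))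

    -- The surplus of x₃ is that of x₁, so the second quotient has the numerator of the first.
    gap : ∀ m k l₁ l₂ → m - k - (m - (k + l₁ - l₂)) ≡ l₁ - l₂
    gap = solve-∀

    m-k′<m-k : m - k′ ℤ.< m - k
    m-k′<m-k = subst₂ ℤ._<_ (left m k l₁ l₂) (right m k l₁) (ℤₚ.+-monoʳ-< (m - k - l₁) l₂<l₁)
      where
      left : ∀ m k l₁ l₂ → m - k - l₁ + l₂ ≡ m - (k + l₁ - l₂)
      left = solve-∀
      right : ∀ m k l₁ → m - k - l₁ + l₁ ≡ m - k
      right = solve-∀

∈-above : ∀ l₂ hi {l₁} → l₁ ∈ ⟦ l₂ + + 2 ⋯ hi ⟧ → l₂ ℤ.< l₁
∈-above l₂ hi l₁∈ with (d , refl) , _ ← ∈-⟦⟧⁻ (l₂ + + 2) hi l₁∈ =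
  subst₂ ℤ._<_ (ℤₚ.+-identityʳ l₂) (sym (ℤₚ.+-assoc l₂ (+ 2) (+ d)))
    (ℤₚ.+-monoʳ-< l₂ (ℤ.+<+ (s≤s z≤n)))

mainTheorem8 : ∀ (n′ g′ : ℕ) → 2 ≤ n′ → 3 ≤ g′ →
    let n = + n′
        g = + g′
    in
    fromℕ (𝓜ᵒ g′ n′) ≡
    fromℕ 2 *
      (∑[ i from g + + 1 to n - + 1 ]
       ∑[ l₂ from + 0 to n - i - + 2 ]
       ∑[ l₁ from l₂ + + 2 to n - i ]
       ∑[ k from l₁ to g + l₂ ]
        let j   = n + g - i
            k′  = k + l₁ - l₂
            Al₁ = (l₁ , n - i - l₁)
            Al₂ = (l₂ , n - i - l₂)
            Ak  = (k , j - k)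
        in
        ∑[ m from k′ to n - j + k ]
          ((l₁ - l₂) // (n - i)
            * fromℕ (binom (n - i) l₁)
            * fromℕ (binom (n - i) l₂)
            * fromℕ (∣𝒩∣ Al₂ Al₁ Ak)
            * ((l₁ - l₂) // (n - j))
            * fromℕ (binom (n - j) (m - k))
            * fromℕ (binom (n - j) (m - k′))))
mainTheorem8 n g _ 3≤g = trans
  (cong fromℕ (𝓜ᵒ≡2*above (ℕₚ.≤-trans (s≤s z≤n) 3≤g)
    (respᴱ (fibre₀⇒above n g , above⇒fibre₀ n g (ℕₚ.≤-trans (s≤s (s≤s z≤n)) 3≤g)) (fibre₀ᴱ n g))))
  (trans (fromℕ-* 2 (size (fibre₀ᴱ n g))) (cong (fromℕ 2 *_)
    -- One application per sum, the summand being inferred from the goal. Membership of l₁ in its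
    -- range is kept, as it supplies l₂ < l₁ for the closed forms.
    (fromℕ-size-rangeᴱ (i-fibre n g) (+ g + + 1) (+ n - + 1) (fibre₁ᴱ n g) _ λ i _ →
     fromℕ-size-rangeᴱ (l₂-fibre n g i) (+ 0) (+ n - i - + 2) (fibre₂ᴱ n g i) _ λ l₂ _ →
     fromℕ-size-rangeᴱ (l₁-fibre n g i l₂) (l₂ + + 2) (+ n - i) (fibre₃ᴱ n g i l₂) _ λ l₁ l₁∈ →
     fromℕ-size-rangeᴱ (k-fibre n g i l₂ l₁) l₁ (+ g + l₂) (fibre₄ᴱ n g i l₂ l₁) _ λ k _ →
     fromℕ-size-rangeᴱ (m-fibre n g i l₂ l₁ k) (k + l₁ - l₂) (+ n - (+ n + + g - i) + k)
       (fibreᴱ n g i l₂ l₁ k) _ λ m _ →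
     size-fibre n g i l₂ l₁ k m (∈-above l₂ (+ n - i) l₁∈))))
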